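{- For all integers $C\ge 2$, $\rho\ge 1$ and every $\epsilon>0$, there is an instance of \textsc{L-Sided Pricing} in which every $u\in L$ has capacity $C$ and every $v\in R$ has capacity $1$, whose locality gap with respect to the $\rho$-swap heuristic is at least $\frac{2C-1}{C}-\epsilon$.
   Context: An instance of \textsc{L-Sided Pricing} consists of a finite bipartite graph $G=(L\cup R,E)$ (each edge joins $L$ and $R$), a capacity $\mu_w\in\mathbb Z_{\ge 0}\cup\{\infty\}$ for every vertex $w$, and a budget $b_e\ge 0$ for every edge $e$. For $u\in L$ let $P_u=\{b_e: e\in E\text{ incident to }u\}$. A pricing is a function $p$ on $L$ with $p(u)\in P_u$ for every $u\in L$, extended by $p(v)=0$ for $v\in R$. For a pricing $p$, $\mathrm{val}(p)$ is the maximum of $\sum_{e=uv\in F}(p(u)+p(v))$ over all $F\subseteq E$ such that $p(u)+p(v)\le b_e$ for every $e=uv\in F$ and every vertex $w$ is incident to at most $\mu_w$ edges of $F$. Let $p^*$ be a pricing maximizing $\mathrm{val}$. For $\rho\ge1$, the locality gap of the instance with respect to the $\rho$-swap heuristic is the maximum of $\mathrm{val}(p^*)/\mathrm{val}(p)$ over all pricings $p$ such that $\mathrm{val}(p')\le\mathrm{val}(p)$ for every pricing $p'$ differing from $p$ on at most $\rho$ vertices of $L$. -}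

module Defs where

open import Data.Nat as ℕ using (ℕ)
open import Data.Fin using (Fin)
open import Data.Bool using (Bool; true; false; if_then_else_)
open import Data.Maybe using (Maybe; just; nothing)
open import Data.Product using (Σ; ∃; ∃-syntax; _×_; _,_)
open import Data.List using (List; length)
open import Data.List.Membership.Propositional using (_∈_)
open import Data.Rational using (ℚ; 0ℚ; _+_; _≤_)
open import Relation.Binary.PropositionalEquality using (_≡_)
open import Relation.Nullary using (¬_)
open import Data.Unit using (⊤)

sumℚ : (n : ℕ) → (Fin n → ℚ) → ℚ
sumℚ ℕ.zero    f = 0ℚ
sumℚ (ℕ.suc n) f = f Data.Fin.zero + sumℚ n (λ i → f (Data.Fin.suc i))

countB : (n : ℕ) → (Fin n → Bool) → ℕ
countB ℕ.zero    f = 0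
countB (ℕ.suc n) f = (if f Data.Fin.zero then 1 else 0) ℕ.+ countB n (λ i → f (Data.Fin.suc i))

-- Capacity in ℤ≥0 ∪ {∞}: `nothing` encodes ∞.
Cap : Set
Cap = Maybe ℕ

WithinCap : ℕ → Cap → Set
WithinCap k nothing  = ⊤
WithinCap k (just μ) = k ℕ.≤ μ

-- An instance of L-Sided Pricing.  L = Fin nL, R = Fin nR.
-- The (simple, bipartite) edge set with budgets is given by
-- `budget u v = just b` iff uv ∈ E with budget b_uv = b.
record Instance : Set where
  field
    nL nR   : ℕ
    budget  : Fin nL → Fin nR → Maybe ℚ
    budget≥0 : ∀ u v b → budget u v ≡ just b → 0ℚ ≤ b
    capL    : Fin nL → Cap
    capR    : Fin nR → Cap

module _ (I : Instance) where
  open Instance I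

  -- A pricing: p(u) ∈ P_u = { b_e : e incident to u } (and p(v) = 0 on R).
  Pricing : Set
  Pricing = Σ (Fin nL → ℚ) λ p → ∀ u → ∃[ v ] (budget u v ≡ just (p u))

  -- Edge subsets F ⊆ E (as indicator functions; non-edges must be excluded).
  EdgeSet : Set
  EdgeSet = Fin nL → Fin nR → Bool

  -- F feasible for price vector p: F ⊆ E, p(u)+p(v) = p(u) ≤ b_e on F, capacities respected.
  Feasible : (Fin nL → ℚ) → EdgeSet → Set
  Feasible p F =
    (∀ u v → F u v ≡ true → ∃[ b ] (budget u v ≡ just b × p u ≤ b))
    × (∀ u → WithinCap (countB nR (λ v → F u v)) (capL u))
    × (∀ v → WithinCap (countB nL (λ u → F u v)) (capR v))

  -- Σ_{uv ∈ F} (p(u) + p(v)) with p(v) = 0.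
  revenue : (Fin nL → ℚ) → EdgeSet → ℚ
  revenue p F = sumℚ nL (λ u → sumℚ nR (λ v → if F u v then p u else 0ℚ))

  IsVal : Pricing → ℚ → Set
  IsVal (p , _) x =
    (∃[ F ] (Feasible p F × revenue p F ≡ x))
    × (∀ F → Feasible p F → revenue p F ≤ x)

  DiffersOnAtMost : ℕ → Pricing → Pricing → Set
  DiffersOnAtMost ρ (p , _) (p' , _) =
    ∃[ S ] (length S ℕ.≤ ρ × (∀ u → ¬ (u ∈ S) → p' u ≡ p u))

  LocalOpt : ℕ → Pricing → Set
  LocalOpt ρ p = ∀ p' → DiffersOnAtMost ρ p p' →
    ∀ x x' → IsVal p x → IsVal p' x' → x' ≤ x

{-# OPTIONS --safe #-}
-- Take C permutations of a finite set without short closed reduced walks, arranged in layers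
-- 0, …, D so that every permutation lowers the layer by one, cyclically.  The items are the
-- pairs (v , j): v pays C for (v , j), and its predecessor P j v pays 2C − 1, except that this
-- second edge is missing when v is in layer 0.  Charging C everywhere, every vertex sells its
-- own C items; charging 2C − 1, every vertex outside the top layer sells C items of the next
-- layer.  The ratio tends to (2C − 1)/C as D grows.
--
-- Suppose that T is the set of vertices which raise their price, |T| ≤ ρ.  Let Z be the set of
-- vertices reachable from T along second edges.  As layer 0 is never entered, |Z| is bounded in
-- terms of C, D and ρ, so Z spans a forest.  Every vertex of Z outside T is entered from Z,
-- hence at most |T| edges return from Z to T, and weighting Z and its items accordingly gives a
-- dual solution showing that the swap does not increase the revenue.
module Submission where

open import Defs
open import Data.Nat as ℕ using (ℕ; zero; suc; _^_; z≤n; s≤s; NonZero)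
import Data.Nat.Properties as ℕ
open import Data.Nat.Solver using (module +-*-Solver)
open import Algebra.Properties.Semiring.Sum ℕ.+-*-semiring
open import Data.Bool using (Bool; true; false; not; if_then_else_; _∧_; _∨_)
import Data.Bool.Properties as Bool
open import Data.Fin using (Fin; zero; suc; toℕ; fromℕ; punchIn; combine; quotient; remainder; finToFun; funToFin; opposite; _↑ˡ_; _↑ʳ_)
open import Data.Fin.Properties using (_≟_; any?; toℕ<n; toℕ-injective; remQuot-combine; combine-remQuot; combine-injective; finToFun-funToFin; funToFin-finToFin; opposite-involutive)
open import Data.Fin.Permutation using (Permutation′; permutation; _⟨$⟩ʳ_; _⟨$⟩ˡ_; inverseʳ; inverseˡ; insert; insert-punchIn; id)
import Data.Integer as ℤ
import Data.Integer.Properties as ℤ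
open import Data.Integer using (+_)
open import Data.List using (List; []; _∷_; _++_; length)
open import Data.List.Properties using (length-++)
open import Data.List.Membership.Propositional using (_∈_; _∉_)
open import Data.List.Membership.DecPropositional using (_∈?_)
open import Data.List.Relation.Unary.All as All using (All; []; _∷_)
open import Data.List.Relation.Unary.All.Properties using (¬Any⇒All¬)
open import Data.List.Relation.Unary.AllPairs using ([]; _∷_)
open import Data.List.Relation.Unary.Any using (here; there)
open import Data.List.Relation.Unary.Linked as Linked using (Linked; []; [-]; _∷_)
open import Data.List.Relation.Unary.Unique.Propositional using (Unique)
open import Data.Maybe using (Maybe; just; nothing)
open import Data.Maybe.Properties using (just-injective)
open import Data.Product using (∃; ∃-syntax; _×_; _,_; proj₁; proj₂)
open import Data.Product.Properties using (≡-dec)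
open import Data.Rational using (ℚ; mkℚ; 0ℚ; toℚᵘ; _<_; _≤_; _+_; _-_; -_; _*_; _/_; Positive; nonNegative)
import Data.Rational.Properties as ℚ
open import Data.Rational.Unnormalised as ℚᵘ using (mkℚᵘ; _≃_; *≡*; *≤*; *<*)
import Data.Rational.Unnormalised.Properties as ℚᵘ
open import Data.Sum using (inj₁; inj₂)
open import Data.Empty using (⊥-elim)
open import Function using (_∘_)
open import Relation.Nullary using (Dec; yes; no; does)
open import Relation.Nullary.Decidable using (_×-dec_; _⊎-dec_; ¬?; dec-true; dec-false)
open import Relation.Binary.PropositionalEquality

-- Finite sums of natural numbers.

sum-+ : ∀ m {n} (f : Fin (m ℕ.+ n) → ℕ) →
        sum f ≡ sum (λ i → f (i ↑ˡ n)) ℕ.+ sum (λ i → f (m ↑ʳ i))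
sum-+ zero    f = refl
sum-+ (suc m) f = trans (cong (f zero ℕ.+_) (sum-+ m (f ∘ suc))) (sym (ℕ.+-assoc (f zero) _ _))

sum-combine : ∀ m n (f : Fin (m ℕ.* n) → ℕ) →
              sum f ≡ ∑[ i < m ] ∑[ j < n ] f (combine i j)
sum-combine zero    n f = refl
sum-combine (suc m) n f = trans (sum-+ n f) (cong (sum (λ j → f (j ↑ˡ (m ℕ.* n))) ℕ.+_) (sum-combine m n (λ i → f (n ↑ʳ i))))

sum-const : ∀ n x → ∑[ i < n ] x ≡ n ℕ.* x
sum-const zero    x = refl
sum-const (suc n) x = cong (x ℕ.+_) (sum-const n x)

-- Reduced walks along permutations and the edges they cross.

-- A direction (j , b) follows the j-th permutation forwards (b = true) or backwards (b = false).
Direction : ℕ → Set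
Direction C = Fin C × Bool

bar : ∀ {C} → Direction C → Direction C
bar (j , b) = j , not b

bar-involutive : ∀ {C} (d : Direction C) → bar (bar d) ≡ d
bar-involutive (j , b) = cong (j ,_) (Bool.not-involutive b)

Reduced : ∀ {C} → List (Direction C) → Set
Reduced = Linked (λ d e → e ≢ bar d)

Reduced-++ˡ : ∀ {C} (w : List (Direction C)) {w′} → Reduced (w ++ w′) → Reduced w
Reduced-++ˡ []          _       = []
Reduced-++ˡ (d ∷ [])    _       = [-]
Reduced-++ˡ (d ∷ e ∷ w) (p ∷ r) = p ∷ Reduced-++ˡ (e ∷ w) r

module Walk {C n : ℕ} (P : Fin C → Permutation′ n) where

  step : Direction C → Fin n → Fin n
  step (j , true)  v = P j ⟨$⟩ʳ v
  step (j , false) v = P j ⟨$⟩ˡ v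

  step-bar : ∀ d v → step (bar d) (step d v) ≡ v
  step-bar (j , true)  v = inverseˡ (P j)
  step-bar (j , false) v = inverseʳ (P j)

  run : Fin n → List (Direction C) → Fin n
  run v []      = v
  run v (d ∷ w) = run (step d v) w

  -- A closed walk counts even if its last step reverses its first one. For `k = 1` this already
  -- rules out fixed points, and for `k = 2` also parallel arcs.
  NoShortCycle : ℕ → Set
  NoShortCycle k = ∀ v d w → Reduced (d ∷ w) → length (d ∷ w) ℕ.≤ k → run v (d ∷ w) ≢ v

  -- An edge is coded by its tail and its permutation, so that both directions of crossing it give
  -- the same code.
  edge : Direction C → Fin n → Fin (n ℕ.* C)
  edge (j , true)  v = combine v j
  edge (j , false) v = combine (P j ⟨$⟩ˡ v) j

  edges : Fin n → List (Direction C) → List (Fin (n ℕ.* C))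
  edges v []      = []
  edges v (d ∷ w) = edge d v ∷ edges (step d v) w

  data SameEdge (d : Direction C) (v : Fin n) (e : Direction C) (u : Fin n) : Set where
    forward  : e ≡ d → u ≡ v → SameEdge d v e u
    backward : e ≡ bar d → u ≡ step d v → SameEdge d v e u

  edge-injective : ∀ d v e u → edge e u ≡ edge d v → SameEdge d v e u
  edge-injective (j , true) v (i , true) u eq with combine-injective u i v j eq
  ... | refl , refl = forward refl refl
  edge-injective (j , false) v (i , true) u eq with combine-injective u i _ j eq
  ... | refl , refl = backward refl refl
  edge-injective (j , true) v (i , false) u eq with combine-injective _ i v j eq
  ... | refl , refl = backward refl (sym (inverseʳ (P i)))
  edge-injective (j , false) v (i , false) u eq with combine-injective _ i _ j eq
  ... | p , refl = forward refl (trans (sym (inverseʳ (P i))) (trans (cong (P i ⟨$⟩ʳ_) p) (inverseʳ (P i))))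

  edges-split : ∀ {e} v w → e ∈ edges v w →
                ∃ λ w₁ → ∃ λ d → ∃ λ w₂ → w ≡ w₁ ++ d ∷ w₂ × edge d (run v w₁) ≡ e
  edges-split v (d ∷ w) (here p) = [] , d , w , refl , sym p
  edges-split v (d ∷ w) (there p) with edges-split (step d v) w p
  ... | w₁ , d′ , w₂ , refl , q = d ∷ w₁ , d′ , w₂ , refl , q

-- The homology cover and its girth.

-- Bit vectors indexed by Fin m are coded as elements of Fin (2 ^ m).
module Bits {m : ℕ} where

  bit : Fin m → Fin (2 ^ m) → Fin 2
  bit e x = finToFun x e

  flipBit : Fin m → Fin (2 ^ m) → Fin (2 ^ m)
  flipBit e x = funToFin (λ e′ → if does (e ≟ e′) then opposite (bit e′ x) else bit e′ x)

  bit-flip-≡ : ∀ e x → bit e (flipBit e x) ≡ opposite (bit e x)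
  bit-flip-≡ e x rewrite finToFun-funToFin (λ e′ → if does (e ≟ e′) then opposite (bit e′ x) else bit e′ x) e
    with e ≟ e
  ... | yes _ = refl
  ... | no ¬p = ⊥-elim (¬p refl)

  bit-flip-≢ : ∀ {e e′} x → e ≢ e′ → bit e′ (flipBit e x) ≡ bit e′ x
  bit-flip-≢ {e} {e′} x e≢e′ rewrite finToFun-funToFin (λ e′ → if does (e ≟ e′) then opposite (bit e′ x) else bit e′ x) e′
    with e ≟ e′
  ... | yes p = ⊥-elim (e≢e′ p)
  ... | no _  = refl

  funToFin-cong : ∀ {k l} {f g : Fin k → Fin l} → f ≗ g → funToFin f ≡ funToFin g
  funToFin-cong {zero}  f≗g = refl
  funToFin-cong {suc k} f≗g = cong₂ combine (f≗g zero) (funToFin-cong (f≗g ∘ suc))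

  bit-ext : ∀ {x y} → (∀ e → bit e x ≡ bit e y) → x ≡ y
  bit-ext {x} {y} p = trans (sym (funToFin-finToFin {m} {2} x)) (trans (funToFin-cong p) (funToFin-finToFin {m} {2} y))

  flipBit-involutive : ∀ e x → flipBit e (flipBit e x) ≡ x
  flipBit-involutive e x = bit-ext go
    where
    go : ∀ e′ → bit e′ (flipBit e (flipBit e x)) ≡ bit e′ x
    go e′ with e ≟ e′
    ... | yes refl = trans (bit-flip-≡ e _) (trans (cong opposite (bit-flip-≡ e x)) (opposite-involutive _))
    ... | no e≢e′  = trans (bit-flip-≢ _ e≢e′) (bit-flip-≢ x e≢e′)

opposite-≢ : (b : Fin 2) → opposite b ≢ b
opposite-≢ zero       ()
opposite-≢ (suc zero) ()

-- The ℤ₂-homology cover: vertices carry one bit per edge of the base graph, and crossing an edge flips its bit.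
module Cover {C n : ℕ} (P : Fin C → Permutation′ n) where
  open Walk P
  open Bits {n ℕ.* C}

  base : Fin (n ℕ.* 2 ^ (n ℕ.* C)) → Fin n
  base = quotient (2 ^ (n ℕ.* C))

  bits : Fin (n ℕ.* 2 ^ (n ℕ.* C)) → Fin (2 ^ (n ℕ.* C))
  bits = remainder {n} (2 ^ (n ℕ.* C))

  base-combine : ∀ v x → base (combine v x) ≡ v
  base-combine v x = cong proj₁ (remQuot-combine v x)

  bits-combine : ∀ (v : Fin n) x → bits (combine v x) ≡ x
  bits-combine v x = cong proj₂ (remQuot-combine v x)

  move : Direction C → Fin (n ℕ.* 2 ^ (n ℕ.* C)) → Fin (n ℕ.* 2 ^ (n ℕ.* C))
  move d w = combine (step d (base w)) (flipBit (edge d (base w)) (bits w))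

  edge-bar : ∀ d v → edge (bar d) (step d v) ≡ edge d v
  edge-bar (j , true)  v = cong (λ u → combine u j) (inverseˡ (P j))
  edge-bar (j , false) v = refl

  move-bar : ∀ d w → move (bar d) (move d w) ≡ w
  move-bar d w = begin
    move (bar d) (move d w)
      ≡⟨ cong₂ (λ v x → combine (step (bar d) v) (flipBit (edge (bar d) v) x)) (base-combine _ _) (bits-combine _ _) ⟩
    combine (step (bar d) (step d v)) (flipBit (edge (bar d) (step d v)) (flipBit (edge d v) (bits w)))
      ≡⟨ cong₂ combine (step-bar d v) (trans (cong (λ e → flipBit e (flipBit (edge d v) (bits w))) (edge-bar d v)) (flipBit-involutive (edge d v) (bits w))) ⟩
    combine v (bits w)
      ≡⟨ combine-remQuot {n} _ w ⟩
    w ∎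
    where
    open ≡-Reasoning
    v = base w

  cover : Fin C → Permutation′ (n ℕ.* 2 ^ (n ℕ.* C))
  cover j = permutation (move (j , true)) (move (j , false)) (move-bar (j , false)) (move-bar (j , true))

  open Walk cover using () renaming (step to step↑; run to run↑; NoShortCycle to NoShortCycle↑)

  step↑≡move : ∀ d w → step↑ d w ≡ move d w
  step↑≡move (j , true)  w = refl
  step↑≡move (j , false) w = refl

  base-step : ∀ d w → base (step↑ d w) ≡ step d (base w)
  base-step d w = trans (cong base (step↑≡move d w)) (base-combine _ _)

  bits-step : ∀ d w → bits (step↑ d w) ≡ flipBit (edge d (base w)) (bits w)
  bits-step d w = trans (cong bits (step↑≡move d w)) (bits-combine (step d (base w)) _)

  base-run : ∀ w ds → base (run↑ w ds) ≡ run (base w) ds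
  base-run w []       = refl
  base-run w (d ∷ ds) = trans (base-run (step↑ d w) ds) (cong (λ v → run v ds) (base-step d w))

  -- A step flips only the bit of the edge that it crosses.
  bit-run : ∀ {e} w ds → e ∉ edges (base w) ds → bit e (bits (run↑ w ds)) ≡ bit e (bits w)
  bit-run w [] _ = refl
  bit-run {e} w (d ∷ ds) e∉ = begin
    bit e (bits (run↑ (step↑ d w) ds))
      ≡⟨ bit-run (step↑ d w) ds (λ e∈ → e∉ (there (subst (λ v → e ∈ edges v ds) (base-step d w) e∈))) ⟩
    bit e (bits (step↑ d w))
      ≡⟨ cong (bit e) (bits-step d w) ⟩
    bit e (flipBit (edge d (base w)) (bits w))
      ≡⟨ bit-flip-≢ (bits w) (λ p → e∉ (here (sym p))) ⟩
    bit e (bits w) ∎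
    where open ≡-Reasoning

  -- A closed walk upstairs crosses its first edge a second time, and until then it
  -- describes a shorter closed reduced walk downstairs.
  cover-girth : ∀ {k} → NoShortCycle k → NoShortCycle↑ (suc k)
  cover-girth {k} short w d ds red (s≤s len) closed = opposite-≢ (bit e₀ (bits w)) (begin
    opposite (bit e₀ (bits w))  ≡⟨ bit-flip-≡ e₀ (bits w) ⟨
    bit e₀ (flipBit e₀ (bits w)) ≡⟨ cong (bit e₀) (bits-step d w) ⟨
    bit e₀ (bits (step↑ d w))   ≡⟨ bit-run (step↑ d w) ds (λ e∈ → once (subst (λ v → e₀ ∈ edges v ds) (base-step d w) e∈)) ⟨
    bit e₀ (bits (run↑ w (d ∷ ds))) ≡⟨ cong (bit e₀ ∘ bits) closed ⟩
    bit e₀ (bits w)             ∎)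
    where
    open ≡-Reasoning
    v = base w
    e₀ = edge d v
    -- The second crossing `d′` is itself left out of the cut walk; this is the one step gained over
    -- `k`.
    prefix : ∀ ds₁ {d′ ds₂} → ds ≡ ds₁ ++ d′ ∷ ds₂ → length ds₁ ℕ.< k
    prefix ds₁ {d′} {ds₂} refl = ℕ.≤-trans (s≤s (ℕ.m≤m+n _ _)) (ℕ.≤-trans (ℕ.≤-reflexive (trans (sym (ℕ.+-suc _ _)) (sym (length-++ ds₁)))) len)
    -- Cut the walk where `e₀` recurs. Crossed in the same direction, the walk has returned to `v`;
    -- crossed in reverse, it has returned to `step d v`, unless nothing lies in between, and then
    -- it backtracks.
    once : e₀ ∉ edges (step d v) ds
    once e∈ with edges-split (step d v) ds e∈
    ... | ds₁ , d′ , ds₂ , eq , same with edge-injective d v d′ _ same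
    once e∈ | ds₁ , d′ , ds₂ , eq , same | forward _ back =
      short v d ds₁ (Reduced-++ˡ (d ∷ ds₁) (subst (λ ds → Reduced (d ∷ ds)) eq red)) (prefix ds₁ eq) back
    once e∈ | [] , d′ , ds₂ , refl , same | backward turn _ = Linked.head red turn
    once e∈ | d₁ ∷ ds₁ , d′ , ds₂ , refl , same | backward _ back =
      short (step d v) d₁ ds₁ (Reduced-++ˡ (d₁ ∷ ds₁) (Linked.tail red)) (ℕ.<⇒≤ (prefix (d₁ ∷ ds₁) refl)) back

-- Layered permutations without short cycles.

-- The cyclic shift that lowers every positive layer by one and sends layer 0 to the top layer `D`.
rotation : ∀ D → Permutation′ (suc D)
rotation D = insert zero (fromℕ D) id

toℕ-punchIn-fromℕ : ∀ {D} (i : Fin D) → toℕ (punchIn (fromℕ D) i) ≡ toℕ i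
toℕ-punchIn-fromℕ zero    = refl
toℕ-punchIn-fromℕ (suc i) = cong suc (toℕ-punchIn-fromℕ i)

toℕ-rotation-suc : ∀ {D} (i : Fin D) → toℕ (rotation D ⟨$⟩ʳ suc i) ≡ toℕ i
toℕ-rotation-suc {D} i = trans (cong toℕ (insert-punchIn zero (fromℕ D) id i)) (toℕ-punchIn-fromℕ i)

-- `sum-layer` expresses that each of the `D + 1` layers has exactly `M` vertices, in the form
-- needed to turn sums over vertices into sums over layers.
record LayeredGraph (D C k : ℕ) : Set where
  field
    n M    : ℕ
    P      : Fin C → Permutation′ n
    layer  : Fin n → Fin (suc D)
    layer-P : ∀ j v → layer (P j ⟨$⟩ʳ v) ≡ rotation D ⟨$⟩ʳ layer v
    sum-layer : ∀ f → sum (f ∘ layer) ≡ M ℕ.* sum f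
    M>0    : 0 ℕ.< M
    girth  : Walk.NoShortCycle P k

-- Start with one vertex per layer and all permutations equal to the rotation, where girth bound 0
-- is vacuous. Each cover raises the bound by one, and the layers are pulled back along `base`, so
-- every layer grows by the same factor.
layeredGraph : ∀ D C k → LayeredGraph D C k
layeredGraph D C zero = record
  { n = suc D ; M = 1 ; P = λ _ → rotation D ; layer = λ v → v ; layer-P = λ _ _ → refl
  ; sum-layer = λ f → sym (ℕ.*-identityˡ _) ; M>0 = s≤s z≤n ; girth = λ _ _ _ _ () }
layeredGraph D C (suc k) = record
  { n = n ℕ.* 2 ^ (n ℕ.* C) ; M = 2 ^ (n ℕ.* C) ℕ.* M ; P = cover ; layer = layer ∘ base
  ; layer-P = λ j w → trans (cong layer (base-step (j , true) w)) (layer-P j (base w))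
  ; sum-layer = sum-cover
  ; M>0 = ℕ.*-mono-≤ {1} {_} {1} (ℕ.m^n>0 2 (n ℕ.* C)) M>0
  ; girth = cover-girth girth }
  where
  open LayeredGraph (layeredGraph D C k)
  open Cover P
  sum-cover : ∀ f → sum (f ∘ layer ∘ base) ≡ (2 ^ (n ℕ.* C) ℕ.* M) ℕ.* sum f
  sum-cover f = begin
    sum (f ∘ layer ∘ base)
      ≡⟨ sum-combine n (2 ^ (n ℕ.* C)) (f ∘ layer ∘ base) ⟩
    sum {n} (λ v → ∑[ x < 2 ^ (n ℕ.* C) ] f (layer (base (combine v x))))
      ≡⟨ sum-cong-≗ {n} (λ v → trans (sum-cong-≗ (λ x → cong (f ∘ layer) (base-combine v x))) (sum-const (2 ^ (n ℕ.* C)) (f (layer v)))) ⟩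
    sum {n} (λ v → 2 ^ (n ℕ.* C) ℕ.* f (layer v))
      ≡⟨ *-distribˡ-sum (2 ^ (n ℕ.* C)) (f ∘ layer) ⟨
    2 ^ (n ℕ.* C) ℕ.* sum (f ∘ layer)
      ≡⟨ cong (2 ^ (n ℕ.* C) ℕ.*_) (sum-layer f) ⟩
    2 ^ (n ℕ.* C) ℕ.* (M ℕ.* sum f)
      ≡⟨ ℕ.*-assoc (2 ^ (n ℕ.* C)) M _ ⟨
    (2 ^ (n ℕ.* C) ℕ.* M) ℕ.* sum f ∎
    where open ≡-Reasoning

-- Counting with indicator functions.

sum-mono : ∀ {n} {f g : Fin n → ℕ} → (∀ i → f i ℕ.≤ g i) → sum f ℕ.≤ sum g
sum-mono {zero}  f≤g = z≤n
sum-mono {suc n} f≤g = ℕ.+-mono-≤ (f≤g zero) (sum-mono (f≤g ∘ suc))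

term≤sum : ∀ {n} (f : Fin n → ℕ) i → f i ℕ.≤ sum f
term≤sum f zero    = ℕ.m≤m+n (f zero) _
term≤sum f (suc i) = ℕ.≤-trans (term≤sum (f ∘ suc) i) (ℕ.m≤n+m _ (f zero))

𝟙 : Bool → ℕ
𝟙 b = if b then 1 else 0

δ : ∀ {n} → Fin n → Fin n → ℕ
δ u v = 𝟙 (does (u ≟ v))

sum-δ : ∀ {n} (u : Fin n) (f : Fin n → ℕ) → sum (λ v → δ u v ℕ.* f v) ≡ f u
sum-δ {suc n} zero f = begin
  f zero ℕ.+ 0 ℕ.+ sum {n} (λ v → 0)  ≡⟨ cong (f zero ℕ.+ 0 ℕ.+_) (trans (sum-const n 0) (ℕ.*-zeroʳ n)) ⟩
  f zero ℕ.+ 0 ℕ.+ 0                  ≡⟨ trans (ℕ.+-identityʳ _) (ℕ.+-identityʳ _) ⟩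
  f zero ∎
  where open ≡-Reasoning
sum-δ {suc n} (suc u) f = sum-δ u (f ∘ suc)

δ-sym : ∀ {n} (u v : Fin n) → δ u v ≡ δ v u
δ-sym u v with u ≟ v | v ≟ u
... | yes _ | yes _ = refl
... | no _  | no _  = refl
... | yes p | no ¬p = ⊥-elim (¬p (sym p))
... | no ¬p | yes p = ⊥-elim (¬p (sym p))

sum-if-δ : ∀ {n} (u : Fin n) (f : Fin n → ℕ) → sum (λ v → if does (u ≟ v) then f v else 0) ≡ f u
sum-if-δ u f = trans (sum-cong-≗ eq) (sum-δ u f)
  where
  eq : ∀ v → (if does (u ≟ v) then f v else 0) ≡ δ u v ℕ.* f v
  eq v with does (u ≟ v)
  ... | true  = sym (ℕ.+-identityʳ (f v))
  ... | false = refl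

sum-perm : ∀ {n} (f : Fin n → ℕ) (π : Permutation′ n) → sum (λ v → f (π ⟨$⟩ʳ v)) ≡ sum f
sum-perm f π = sym (sum-permute f π)

size : ∀ {n} → (Fin n → Bool) → ℕ
size Z = sum (𝟙 ∘ Z)

infixl 6 _∖_
_∖_ : ∀ {n} → (Fin n → Bool) → Fin n → Fin n → Bool
(Z ∖ x) v = Z v ∧ not (does (x ≟ v))

𝟙-remove : ∀ {n} (Z : Fin n → Bool) {x} → Z x ≡ true → ∀ v → 𝟙 (Z v) ≡ δ x v ℕ.+ 𝟙 ((Z ∖ x) v)
𝟙-remove Z {x} Zx v with x ≟ v
... | yes refl rewrite Zx = refl
... | no _ = cong 𝟙 (sym (Bool.∧-identityʳ (Z v)))

size-remove : ∀ {n} (Z : Fin n → Bool) {x} → Z x ≡ true → size Z ≡ suc (size (Z ∖ x))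
size-remove Z {x} Zx = begin
  size Z                                ≡⟨ sum-cong-≗ (𝟙-remove Z Zx) ⟩
  sum (λ v → δ x v ℕ.+ 𝟙 ((Z ∖ x) v))   ≡⟨ ∑-distrib-+ (δ x) (𝟙 ∘ (Z ∖ x)) ⟩
  sum (δ x) ℕ.+ size (Z ∖ x)            ≡⟨ cong (ℕ._+ size (Z ∖ x)) (trans (sum-cong-≗ (λ v → sym (ℕ.*-identityʳ (δ x v)))) (sum-δ x (λ _ → 1))) ⟩
  suc (size (Z ∖ x)) ∎
  where open ≡-Reasoning

length-unique : ∀ {n} (Z : Fin n → Bool) {xs} → Unique xs → All (λ x → Z x ≡ true) xs → length xs ℕ.≤ size Z
length-unique Z [] [] = z≤n
length-unique Z {x ∷ xs} (x∉ ∷ u) (Zx ∷ Zxs) rewrite size-remove Z Zx =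
  s≤s (length-unique (Z ∖ x) u (All.zipWith (λ {y} (x≢y , Zy) → remains y x≢y Zy) (x∉ , Zxs)))
  where
  remains : ∀ y → x ≢ y → Z y ≡ true → (Z ∖ x) y ≡ true
  remains y x≢y Zy rewrite Zy = cong not (dec-false (x ≟ y) x≢y)

size≤length : ∀ {n} (Z : Fin n → Bool) xs → (∀ x → Z x ≡ true → x ∈ xs) → size Z ℕ.≤ length xs
size≤length {n} Z [] cover = ℕ.≤-trans (sum-mono (λ v → empty v)) (ℕ.≤-reflexive (trans (sum-const n 0) (ℕ.*-zeroʳ n)))
  where
  empty : ∀ v → 𝟙 (Z v) ℕ.≤ 0
  empty v with Z v in eq
  ... | false = z≤n
  ... | true with () ← cover v eq
size≤length Z (x ∷ xs) cover with Z x in Zx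
... | true = ℕ.≤-trans (ℕ.≤-reflexive (size-remove Z Zx)) (s≤s (size≤length (Z ∖ x) xs shrink))
  where
  shrink : ∀ y → (Z ∖ x) y ≡ true → y ∈ xs
  shrink y eq with Z y in Zy | x ≟ y
  shrink y () | true  | yes _
  shrink y () | false | yes _
  shrink y () | false | no _
  ... | true | no x≢y with cover y Zy
  ...   | here y≡x = ⊥-elim (x≢y (sym y≡x))
  ...   | there p  = p
... | false = ℕ.m≤n⇒m≤1+n (size≤length Z xs shrink)
  where
  shrink : ∀ y → Z y ≡ true → y ∈ xs
  shrink y Zy with cover y Zy
  ... | here refl with () ← trans (sym Zx) Zy
  ... | there p = p

-- Small vertex sets span at most as many arcs as they have vertices.

module Forest {C n : ℕ} (P : Fin C → Permutation′ n) (K : ℕ) (short : Walk.NoShortCycle P K) where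
  open Walk P

  In : (Fin n → Bool) → Fin n → Set
  In Z v = Z v ≡ true

  -- The bilinear form of the arcs `v → P j v`. With the indicator of `Z` in both places it counts
  -- the arcs inside `Z`.
  arcs : (Fin n → ℕ) → (Fin n → ℕ) → ℕ
  arcs f g = ∑[ j < C ] ∑[ v < n ] (f (P j ⟨$⟩ʳ v) ℕ.* g v)

  degree : (Fin n → Bool) → Fin n → ℕ
  degree Z v = ∑[ j < C ] (𝟙 (Z (P j ⟨$⟩ʳ v)) ℕ.+ 𝟙 (Z (P j ⟨$⟩ˡ v)))

  trace : Fin n → List (Direction C) → List (Fin n)
  trace v []      = v ∷ []
  trace v (d ∷ w) = v ∷ trace (step d v) w

  length-trace : ∀ v w → length (trace v w) ≡ suc (length w)
  length-trace v []      = refl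
  length-trace v (d ∷ w) = cong suc (length-trace (step d v) w)

  ∈-trace : ∀ {u} v w → u ∈ trace v w → ∃ λ w₁ → ∃ λ w₂ → w ≡ w₁ ++ w₂ × run v w₁ ≡ u
  ∈-trace v []      (here refl) = [] , [] , refl , refl
  ∈-trace v (d ∷ w) (here refl) = [] , d ∷ w , refl , refl
  ∈-trace v (d ∷ w) (there p) with ∈-trace (step d v) w p
  ... | w₁ , w₂ , refl , q = d ∷ w₁ , w₂ , refl , q

  -- A repeated vertex would cut out a closed reduced walk of length at most `K`.
  trace-unique : ∀ v w → Reduced w → length w ℕ.≤ K → Unique (trace v w)
  trace-unique v []      red len = [] ∷ []
  trace-unique v (d ∷ w) red len =
    ¬Any⇒All¬ (trace (step d v) w) fresh ∷ trace-unique (step d v) w (Linked.tail red) (ℕ.<⇒≤ len)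
    where
    fresh : v ∉ trace (step d v) w
    fresh p with ∈-trace (step d v) w p
    ... | w₁ , w₂ , refl , back =
      short v d w₁ (Reduced-++ˡ (d ∷ w₁) red)
        (ℕ.≤-trans (s≤s (ℕ.≤-trans (ℕ.m≤m+n (length w₁) (length w₂)) (ℕ.≤-reflexive (sym (length-++ w₁))))) len) back

  -- Each direction contributes at most one to the degree, so `d` alone cannot account for degree
  -- two.
  continue : ∀ Z v d → 2 ℕ.≤ degree Z v → ∃ λ e → e ≢ d × Z (step e v) ≡ true
  continue Z v d@(i , c) deg with any? (λ j → good? (j , true) ⊎-dec good? (j , false))
    where
    good? : ∀ e → Dec (e ≢ d × Z (step e v) ≡ true)
    good? e = ¬? (≡-dec _≟_ Bool._≟_ e d) ×-dec (Z (step e v) Bool.≟ true)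
  ... | yes (j , inj₁ p) = (j , true) , p
  ... | yes (j , inj₂ p) = (j , false) , p
  ... | no none = ⊥-elim (ℕ.<⇒≱ deg (ℕ.≤-trans (sum-mono bound) (ℕ.≤-reflexive (sum-δ i (λ _ → 1)))))
    where
    no-exit : ∀ e → e ≢ d → Z (step e v) ≡ false
    no-exit e e≢d with Z (step e v) in eq
    no-exit e e≢d | false = refl
    no-exit (j , true)  e≢d | true = ⊥-elim (none (j , inj₁ (e≢d , eq)))
    no-exit (j , false) e≢d | true = ⊥-elim (none (j , inj₂ (e≢d , eq)))
    𝟙≤1 : ∀ b → 𝟙 b ℕ.≤ 1
    𝟙≤1 true  = ℕ.≤-refl
    𝟙≤1 false = z≤n
    bound : ∀ j → 𝟙 (Z (P j ⟨$⟩ʳ v)) ℕ.+ 𝟙 (Z (P j ⟨$⟩ˡ v)) ℕ.≤ δ i j ℕ.* 1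
    bound j with i ≟ j
    ... | no i≢j rewrite no-exit (j , true) (λ p → i≢j (sym (cong proj₁ p))) | no-exit (j , false) (λ p → i≢j (sym (cong proj₁ p))) = z≤n
    bound j | yes refl = one c no-exit
      where
      one : ∀ c → (∀ e → e ≢ (i , c) → Z (step e v) ≡ false) → 𝟙 (Z (P i ⟨$⟩ʳ v)) ℕ.+ 𝟙 (Z (P i ⟨$⟩ˡ v)) ℕ.≤ 1
      one true  out rewrite out (i , false) (λ ()) = ℕ.≤-trans (ℕ.≤-reflexive (ℕ.+-identityʳ _)) (𝟙≤1 (Z (P i ⟨$⟩ʳ v)))
      one false out rewrite out (i , true) (λ ())  = 𝟙≤1 (Z (P i ⟨$⟩ˡ v))

  -- Walks are grown backwards: the newest vertex comes first.
  long-walk : ∀ Z → (∀ v → In Z v → 2 ℕ.≤ degree Z v) → Fin C → ∀ {x} → In Z x →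
              ∀ L → ∃ λ v → ∃ λ w → length w ≡ L × Reduced w × All (In Z) (trace v w)
  long-walk Z deg j {x} Zx zero = x , [] , refl , [] , Zx ∷ []
  long-walk Z deg j Zx (suc L) with long-walk Z deg j Zx L
  -- The empty walk has no step to avoid, and `(j , true)` is an arbitrary choice.
  ... | v , [] , len , red , Zv ∷ [] with continue Z v (j , true) (deg v Zv)
  ...   | e , _ , Ze = step e v , bar e ∷ [] , cong suc len , [-] ,
          Ze ∷ subst (λ u → All (In Z) (trace u [])) (sym (step-bar e v)) (Zv ∷ [])
  long-walk Z deg j Zx (suc L) | v , d ∷ w , len , red , inZ@(Zv ∷ _) with continue Z v d (deg v Zv)
  ...   | e , e≢d , Ze = step e v , bar e ∷ d ∷ w , cong suc len , (λ p → e≢d (sym (trans p (bar-involutive e)))) ∷ red ,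
          Ze ∷ subst (λ u → All (In Z) (trace u (d ∷ w))) (sym (step-bar e v)) inZ

  arcs-δˡ : ∀ x g → arcs (δ x) g ≡ ∑[ j < C ] g (P j ⟨$⟩ˡ x)
  arcs-δˡ x g = sum-cong-≗ λ j → begin
    sum (λ v → δ x (P j ⟨$⟩ʳ v) ℕ.* g v)
      ≡⟨ sum-cong-≗ (λ v → cong (λ u → δ x (P j ⟨$⟩ʳ v) ℕ.* g u) (sym (inverseˡ (P j)))) ⟩
    sum (λ v → δ x (P j ⟨$⟩ʳ v) ℕ.* g (P j ⟨$⟩ˡ (P j ⟨$⟩ʳ v)))
      ≡⟨ sum-perm (λ u → δ x u ℕ.* g (P j ⟨$⟩ˡ u)) (P j) ⟩
    sum (λ u → δ x u ℕ.* g (P j ⟨$⟩ˡ u))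
      ≡⟨ sum-δ x (λ u → g (P j ⟨$⟩ˡ u)) ⟩
    g (P j ⟨$⟩ˡ x) ∎
    where open ≡-Reasoning

  arcs-δʳ : ∀ f x → arcs f (δ x) ≡ ∑[ j < C ] f (P j ⟨$⟩ʳ x)
  arcs-δʳ f x = sum-cong-≗ λ j → trans (sum-cong-≗ (λ v → ℕ.*-comm (f (P j ⟨$⟩ʳ v)) (δ x v))) (sum-δ x (λ v → f (P j ⟨$⟩ʳ v)))

  -- Split the indicator of `Z` as `δ x` plus the rest in both arguments. There is only an
  -- inequality because the degree counts a loop at `x` twice.
  arcs-remove : ∀ Z {x} → In Z x → arcs (𝟙 ∘ Z) (𝟙 ∘ Z) ℕ.≤ degree Z x ℕ.+ arcs (𝟙 ∘ (Z ∖ x)) (𝟙 ∘ (Z ∖ x))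
  arcs-remove Z {x} Zx = begin
    arcs z z
      ≤⟨ sum-mono (λ j → sum-mono (λ v → expand (δ x (P j ⟨$⟩ʳ v)) (z′ (P j ⟨$⟩ʳ v)) (δ x v) (z′ v) (𝟙-remove Z Zx (P j ⟨$⟩ʳ v)) (𝟙-remove Z Zx v))) ⟩
    (∑[ j < C ] sum (λ v → z (P j ⟨$⟩ʳ v) ℕ.* δ x v ℕ.+ δ x (P j ⟨$⟩ʳ v) ℕ.* z v ℕ.+ z′ (P j ⟨$⟩ʳ v) ℕ.* z′ v))
      ≡⟨ sum-cong-≗ (λ j → trans (∑-distrib-+ (λ v → z (P j ⟨$⟩ʳ v) ℕ.* δ x v ℕ.+ δ x (P j ⟨$⟩ʳ v) ℕ.* z v) (λ v → z′ (P j ⟨$⟩ʳ v) ℕ.* z′ v))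
           (cong (ℕ._+ sum (λ v → z′ (P j ⟨$⟩ʳ v) ℕ.* z′ v)) (∑-distrib-+ (λ v → z (P j ⟨$⟩ʳ v) ℕ.* δ x v) (λ v → δ x (P j ⟨$⟩ʳ v) ℕ.* z v)))) ⟩
    (∑[ j < C ] (sum (λ v → z (P j ⟨$⟩ʳ v) ℕ.* δ x v) ℕ.+ sum (λ v → δ x (P j ⟨$⟩ʳ v) ℕ.* z v) ℕ.+ sum (λ v → z′ (P j ⟨$⟩ʳ v) ℕ.* z′ v)))
      ≡⟨ trans (∑-distrib-+ (λ j → sum (λ v → z (P j ⟨$⟩ʳ v) ℕ.* δ x v) ℕ.+ sum (λ v → δ x (P j ⟨$⟩ʳ v) ℕ.* z v)) (λ j → sum (λ v → z′ (P j ⟨$⟩ʳ v) ℕ.* z′ v)))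
           (cong (ℕ._+ arcs z′ z′) (∑-distrib-+ (λ j → sum (λ v → z (P j ⟨$⟩ʳ v) ℕ.* δ x v)) (λ j → sum (λ v → δ x (P j ⟨$⟩ʳ v) ℕ.* z v)))) ⟩
    arcs z (δ x) ℕ.+ arcs (δ x) z ℕ.+ arcs z′ z′
      ≡⟨ cong (ℕ._+ arcs z′ z′) (trans (cong₂ ℕ._+_ (arcs-δʳ z x) (arcs-δˡ x z)) (sym (∑-distrib-+ (λ j → z (P j ⟨$⟩ʳ x)) (λ j → z (P j ⟨$⟩ˡ x))))) ⟩
    degree Z x ℕ.+ arcs z′ z′ ∎
    where
    open ℕ.≤-Reasoning
    z  = 𝟙 ∘ Z
    z′ = 𝟙 ∘ (Z ∖ x)
    expand : ∀ a b c d {s t} → s ≡ a ℕ.+ b → t ≡ c ℕ.+ d → s ℕ.* t ℕ.≤ s ℕ.* c ℕ.+ a ℕ.* t ℕ.+ b ℕ.* d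
    expand a b c d refl refl = ℕ.≤-trans (ℕ.m≤m+n _ (a ℕ.* c)) (ℕ.≤-reflexive
      (solve 4 (λ a b c d → (a :+ b) :* (c :+ d) :+ a :* c := (a :+ b) :* c :+ a :* (c :+ d) :+ b :* d) refl a b c d))
      where open +-*-Solver

  -- Remove vertices of degree at most one; each takes at most one arc with it. If none is left, a
  -- nonempty `Z` would contain a reduced walk of length `size Z`, which visits `size Z + 1`
  -- distinct vertices.
  arcs≤size : ∀ Z → size Z ℕ.≤ K → arcs (𝟙 ∘ Z) (𝟙 ∘ Z) ℕ.≤ size Z
  arcs≤size Z = go (size Z) Z refl
    where
    go : ∀ s Z → size Z ≡ s → s ℕ.≤ K → arcs (𝟙 ∘ Z) (𝟙 ∘ Z) ℕ.≤ s
    go s Z eq s≤K with any? (λ x → (Z x Bool.≟ true) ×-dec (degree Z x ℕ.≤? 1))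
    go zero    Z eq s≤K | yes (x , Zx , deg) with () ← trans (sym eq) (size-remove Z Zx)
    go (suc s) Z eq s≤K | yes (x , Zx , deg) =
      ℕ.≤-trans (arcs-remove Z Zx) (ℕ.+-mono-≤ deg (go s (Z ∖ x) (ℕ.suc-injective (trans (sym (size-remove Z Zx)) eq)) (ℕ.<⇒≤ s≤K)))
    ... | no none = ℕ.≤-trans (sum-mono {g = λ _ → 0} (λ j → ℕ.≤-trans (sum-mono {g = λ _ → 0} (zero-term j)) (ℕ.≤-reflexive (trans (sum-const n 0) (ℕ.*-zeroʳ n)))))
                       (ℕ.≤-trans (ℕ.≤-reflexive (trans (sum-const C 0) (ℕ.*-zeroʳ C))) z≤n)
      where
      deg≥2 : ∀ v → In Z v → 2 ℕ.≤ degree Z v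
      deg≥2 v Zv = ℕ.≰⇒> (λ deg≤1 → none (v , Zv , deg≤1))
      -- The label is needed to start a walk. It is at hand because emptiness is only used inside
      -- the sum over labels.
      empty : Fin C → ∀ v → Z v ≡ false
      empty j v with Z v in Zv
      ... | false = refl
      ... | true with long-walk Z deg≥2 j Zv s
      ...   | u , w , len , red , inZ = ⊥-elim (ℕ.<-irrefl (sym eq) (ℕ.≤-trans (ℕ.≤-reflexive (trans (cong suc (sym len)) (sym (length-trace u w))))
              (length-unique Z (trace-unique u w red (subst (ℕ._≤ K) (sym len) s≤K)) inZ)))
      zero-term : ∀ j v → 𝟙 (Z (P j ⟨$⟩ʳ v)) ℕ.* 𝟙 (Z v) ℕ.≤ 0
      zero-term j v rewrite empty j v = ℕ.≤-reflexive (ℕ.*-zeroʳ (𝟙 (Z (P j ⟨$⟩ʳ v))))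

-- The set of vertices reachable from the swapped vertices.

-- This is `k * (1 + C + … + C ^ m)`, a bound on the number of vertices at most `m` steps away from
-- `k` starting points.
reachBound : ℕ → ℕ → ℕ → ℕ
reachBound C k zero    = k
reachBound C k (suc m) = k ℕ.+ C ℕ.* reachBound C k m

module Reach {D C k : ℕ} (G : LayeredGraph D C k) (T : Fin (LayeredGraph.n G) → Bool) where
  open LayeredGraph G

  level : Fin n → ℕ
  level v = toℕ (layer v)

  prev : Fin C → Fin n → Fin n
  prev j v = P j ⟨$⟩ʳ v

  level-prev : ∀ {m} j v → level v ≡ suc m → level (prev j v) ≡ m
  level-prev j v eq rewrite layer-P j v with layer v | eq
  ... | suc i | refl = toℕ-rotation-suc i

  anyPrev : (Fin n → Bool) → Fin n → Bool
  anyPrev Z v = does (any? (λ j → Z (prev j v) Bool.≟ true))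

  anyPrev⁺ : ∀ Z j v → Z (prev j v) ≡ true → anyPrev Z v ≡ true
  anyPrev⁺ Z j v p = dec-true (any? (λ j → Z (prev j v) Bool.≟ true)) (j , p)

  anyPrev⁻ : ∀ Z v → anyPrev Z v ≡ true → ∃ λ j → Z (prev j v) ≡ true
  anyPrev⁻ Z v eq with any? (λ j → Z (prev j v) Bool.≟ true)
  anyPrev⁻ Z v eq | yes p = p
  anyPrev⁻ Z v () | no _

  -- Steps lead from `prev j v` up to `v`. The step from the top layer into layer 0 is allowed here;
  -- `reach` excludes it by its choice of `m`.
  within : ℕ → Fin n → Bool
  within zero    v = T v
  within (suc m) v = T v ∨ anyPrev (within m) v

  -- A vertex at level l is reachable from T without crossing into level 0
  -- precisely when it is reachable in at most l steps.
  reach : Fin n → Bool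
  reach v = within (level v) v

  T⊆within : ∀ m {v} → T v ≡ true → within m v ≡ true
  T⊆within zero    Tv = Tv
  T⊆within (suc m) Tv rewrite Tv = refl

  within-suc : ∀ m v → within m v ≡ true → within (suc m) v ≡ true
  within-suc zero v eq rewrite eq = refl
  within-suc (suc m) v eq with T v
  ... | true  = refl
  ... | false with anyPrev⁻ (within m) v eq
  ...   | j , p = anyPrev⁺ (within (suc m)) j v (within-suc m (prev j v) p)

  within-mono : ∀ {l m v} → l ℕ.≤ m → within l v ≡ true → within m v ≡ true
  within-mono {l} {m} {v} l≤m eq = go (ℕ.≤⇒≤′ l≤m)
    where
    go : ∀ {m} → l ℕ.≤′ m → within m v ≡ true
    go (ℕ.≤′-reflexive refl) = eq
    go (ℕ.≤′-step {m} p)     = within-suc m v (go p)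

  T⊆reach : ∀ {v} → T v ≡ true → reach v ≡ true
  T⊆reach {v} = T⊆within (level v)

  -- Rising by one level raises the permitted number of steps by one, which pays for the additional
  -- arc.
  reach-closed : ∀ j v → level v ≢ 0 → reach (prev j v) ≡ true → reach v ≡ true
  reach-closed j v l≢0 p with level v in eq
  ... | zero  = ⊥-elim (l≢0 refl)
  ... | suc m rewrite level-prev j v eq | anyPrev⁺ (within m) j v p = Bool.∨-zeroʳ (T v)

  -- At level 0 no step is permitted, so a vertex of `reach` outside `T` has positive level and was
  -- entered from the level below.
  reach-prev : ∀ v → T v ≡ false → reach v ≡ true → ∃ λ j → reach (prev j v) ≡ true
  reach-prev v ¬Tv p with level v in eq
  ... | zero with () ← trans (sym ¬Tv) p
  ... | suc m rewrite ¬Tv with anyPrev⁻ (within m) v p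
  ...   | j , q = j , subst (λ l → within l (prev j v) ≡ true) (sym (level-prev j v eq)) q

  -- For each label the vertices entered from `Z` form the preimage of `Z` under a permutation,
  -- hence a set of the same size.
  size-anyPrev : ∀ Z → size (anyPrev Z) ℕ.≤ C ℕ.* size Z
  size-anyPrev Z = begin
    size (anyPrev Z)
      ≤⟨ sum-mono count ⟩
    sum (λ v → ∑[ j < C ] 𝟙 (Z (prev j v)))
      ≡⟨ ∑-comm (λ v j → 𝟙 (Z (prev j v))) ⟩
    (∑[ j < C ] sum (λ v → 𝟙 (Z (prev j v))))
      ≡⟨ sum-cong-≗ (λ j → sum-perm (𝟙 ∘ Z) (P j)) ⟩
    (∑[ j < C ] size Z)
      ≡⟨ sum-const C (size Z) ⟩
    C ℕ.* size Z ∎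
    where
    open ℕ.≤-Reasoning
    count : ∀ v → 𝟙 (anyPrev Z v) ℕ.≤ ∑[ j < C ] 𝟙 (Z (prev j v))
    count v with anyPrev Z v in eq
    ... | false = z≤n
    ... | true with anyPrev⁻ Z v eq
    ...   | j , p = ℕ.≤-trans (ℕ.≤-reflexive (sym (cong 𝟙 p))) (term≤sum (λ j → 𝟙 (Z (prev j v))) j)

  size-within : ∀ {k} → size T ℕ.≤ k → ∀ m → size (within m) ℕ.≤ reachBound C k m
  size-within T≤k zero = T≤k
  size-within {k} T≤k (suc m) = begin
    size (within (suc m))
      ≤⟨ sum-mono (λ v → 𝟙-∨ (T v) (anyPrev (within m) v)) ⟩
    sum (λ v → 𝟙 (T v) ℕ.+ 𝟙 (anyPrev (within m) v))
      ≡⟨ ∑-distrib-+ (𝟙 ∘ T) (𝟙 ∘ anyPrev (within m)) ⟩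
    size T ℕ.+ size (anyPrev (within m))
      ≤⟨ ℕ.+-mono-≤ T≤k (ℕ.≤-trans (size-anyPrev (within m)) (ℕ.*-monoʳ-≤ C (size-within T≤k m))) ⟩
    k ℕ.+ C ℕ.* reachBound C k m ∎
    where
    open ℕ.≤-Reasoning
    𝟙-∨ : ∀ a b → 𝟙 (a ∨ b) ℕ.≤ 𝟙 a ℕ.+ 𝟙 b
    𝟙-∨ true  b = s≤s z≤n
    𝟙-∨ false b = ℕ.≤-refl

  size-reach : ∀ {k} → size T ℕ.≤ k → size reach ℕ.≤ reachBound C k D
  size-reach T≤k = ℕ.≤-trans (sum-mono λ v → 𝟙-mono (within-mono {m = D} {v} (ℕ.≤-pred (toℕ<n (layer v))))) (size-within T≤k D)
    where
    𝟙-mono : ∀ {a b} → (a ≡ true → b ≡ true) → 𝟙 a ℕ.≤ 𝟙 b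
    𝟙-mono {false} a⇒b = z≤n
    𝟙-mono {true}  a⇒b rewrite a⇒b refl = ℕ.≤-refl

  -- The number of arcs from `reach` into `T`, including those that wrap around into layer 0.
  returns : ℕ
  returns = sum (λ v → ∑[ j < C ] (𝟙 (T v) ℕ.* 𝟙 (reach (prev j v))))

  -- Every vertex of reach outside T has an arc entering it from reach, and reach spans
  -- at most as many arcs as it has vertices.
  returns≤size : size reach ℕ.≤ k → returns ℕ.≤ size T
  returns≤size small = ℕ.+-cancelʳ-≤ (size reach) returns (size T) (begin
    returns ℕ.+ size reach
      ≡⟨ ∑-distrib-+ (λ v → ∑[ j < C ] (𝟙 (T v) ℕ.* 𝟙 (reach (prev j v)))) (𝟙 ∘ reach) ⟨
    sum (λ v → ∑[ j < C ] (𝟙 (T v) ℕ.* 𝟙 (reach (prev j v))) ℕ.+ 𝟙 (reach v))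
      ≤⟨ sum-mono pointwise ⟩
    sum (λ v → 𝟙 (T v) ℕ.+ ∑[ j < C ] (𝟙 (reach (prev j v)) ℕ.* 𝟙 (reach v)))
      ≡⟨ ∑-distrib-+ (𝟙 ∘ T) (λ v → ∑[ j < C ] (𝟙 (reach (prev j v)) ℕ.* 𝟙 (reach v))) ⟩
    size T ℕ.+ sum (λ v → ∑[ j < C ] (𝟙 (reach (prev j v)) ℕ.* 𝟙 (reach v)))
      ≡⟨ cong (size T ℕ.+_) (∑-comm (λ v j → 𝟙 (reach (prev j v)) ℕ.* 𝟙 (reach v))) ⟩
    size T ℕ.+ arcs (𝟙 ∘ reach) (𝟙 ∘ reach)
      ≤⟨ ℕ.+-monoʳ-≤ (size T) (arcs≤size reach small) ⟩
    size T ℕ.+ size reach ∎)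
    where
    open Forest P k girth using (arcs; arcs≤size)
    open ℕ.≤-Reasoning
    pointwise : ∀ v → ∑[ j < C ] (𝟙 (T v) ℕ.* 𝟙 (reach (prev j v))) ℕ.+ 𝟙 (reach v)
                      ℕ.≤ 𝟙 (T v) ℕ.+ ∑[ j < C ] (𝟙 (reach (prev j v)) ℕ.* 𝟙 (reach v))
    pointwise v with T v in Tv | reach v in Rv
    ... | true  | false with () ← trans (sym Rv) (T⊆reach Tv)
    ... | true  | true  = ℕ.≤-reflexive (trans (ℕ.+-comm _ 1) (cong suc (sum-cong-≗ (λ j → ℕ.*-comm 1 (𝟙 (reach (prev j v)))))))
    ... | false | false = ℕ.≤-trans (ℕ.≤-reflexive (trans (ℕ.+-identityʳ _) (trans (sum-const C 0) (ℕ.*-zeroʳ C)))) z≤n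
    ... | false | true with reach-prev v Tv Rv
    ...   | j , p = ℕ.≤-trans (ℕ.≤-reflexive (cong (ℕ._+ 1) (trans (sum-const C 0) (ℕ.*-zeroʳ C))))
                (ℕ.≤-trans (ℕ.≤-reflexive (sym (cong (λ b → 𝟙 b ℕ.* 1) p))) (term≤sum (λ j → 𝟙 (reach (prev j v)) ℕ.* 1) j))

-- Natural numbers inside the rationals.

toℚᵘ-/ : ∀ n d → toℚᵘ (+ n / suc d) ≃ mkℚᵘ (+ n) d
toℚᵘ-/ n d = ℚ.toℚᵘ-fromℚᵘ (mkℚᵘ (+ n) d)

opaque
  ι : ℕ → ℚ
  ι n = + n / 1

  ι-0 : ι 0 ≡ 0ℚ
  ι-0 = refl

  ι-+ : ∀ m n → ι (m ℕ.+ n) ≡ ι m + ι n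
  ι-+ m n = ℚ.toℚᵘ-injective (begin-equality
    toℚᵘ (ι (m ℕ.+ n))            ≃⟨ toℚᵘ-/ (m ℕ.+ n) 0 ⟩
    mkℚᵘ (+ (m ℕ.+ n)) 0          ≃⟨ *≡* (cong (ℤ._* + 1) (sym (cong₂ ℤ._+_ (ℤ.*-identityʳ (+ m)) (ℤ.*-identityʳ (+ n))))) ⟩
    mkℚᵘ (+ m) 0 ℚᵘ.+ mkℚᵘ (+ n) 0 ≃⟨ ℚᵘ.+-cong (toℚᵘ-/ m 0) (toℚᵘ-/ n 0) ⟨
    toℚᵘ (ι m) ℚᵘ.+ toℚᵘ (ι n)    ≃⟨ ℚ.toℚᵘ-homo-+ (ι m) (ι n) ⟨
    toℚᵘ (ι m + ι n)              ∎)
    where open ℚᵘ.≤-Reasoning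

  -- Cross-multiplication. The case `d = 0` gives multiplicativity of `ι`; the general case clears
  -- the denominator of the locality gap.
  /-*-ι : ∀ h d k m → h ℕ.* k ≡ m ℕ.* suc d → (+ h / suc d) * ι k ≡ ι m
  /-*-ι h d k m eq = ℚ.toℚᵘ-injective (begin-equality
    toℚᵘ ((+ h / suc d) * ι k)         ≃⟨ ℚ.toℚᵘ-homo-* (+ h / suc d) (ι k) ⟩
    toℚᵘ (+ h / suc d) ℚᵘ.* toℚᵘ (ι k) ≃⟨ ℚᵘ.*-cong (toℚᵘ-/ h d) (toℚᵘ-/ k 0) ⟩
    mkℚᵘ (+ h) d ℚᵘ.* mkℚᵘ (+ k) 0     ≃⟨ *≡* cross ⟩
    mkℚᵘ (+ m) 0                       ≃⟨ toℚᵘ-/ m 0 ⟨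
    toℚᵘ (ι m)                         ∎)
    where
    open ℚᵘ.≤-Reasoning
    cross : (+ h ℤ.* + k) ℤ.* + 1 ≡ + m ℤ.* + (suc d ℕ.* 1)
    cross = trans (ℤ.*-identityʳ _) (trans (sym (ℤ.pos-* h k)) (trans (cong +_ (trans eq (cong (m ℕ.*_) (sym (ℕ.*-identityʳ (suc d)))))) (ℤ.pos-* m (suc d ℕ.* 1))))

  ι-* : ∀ m n → ι (m ℕ.* n) ≡ ι m * ι n
  ι-* m n = sym (/-*-ι m 0 n (m ℕ.* n) (sym (ℕ.*-identityʳ (m ℕ.* n))))

  ι-mono-≤ : ∀ {m n} → m ℕ.≤ n → ι m ≤ ι n
  ι-mono-≤ {m} {n} m≤n = ℚ.toℚᵘ-cancel-≤ (begin
    toℚᵘ (ι m)   ≃⟨ toℚᵘ-/ m 0 ⟩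
    mkℚᵘ (+ m) 0 ≤⟨ *≤* (ℤ.*-monoʳ-≤-nonNeg (+ 1) (ℤ.+≤+ m≤n)) ⟩
    mkℚᵘ (+ n) 0 ≃⟨ toℚᵘ-/ n 0 ⟨
    toℚᵘ (ι n)   ∎)
    where open ℚᵘ.≤-Reasoning

  ι-mono-< : ∀ {m n} → m ℕ.< n → ι m < ι n
  ι-mono-< {m} {n} m<n = ℚ.toℚᵘ-cancel-< (begin-strict
    toℚᵘ (ι m)   ≃⟨ toℚᵘ-/ m 0 ⟩
    mkℚᵘ (+ m) 0 <⟨ *<* (ℤ.*-monoʳ-<-pos (+ 1) (ℤ.+<+ m<n)) ⟩
    mkℚᵘ (+ n) 0 ≃⟨ toℚᵘ-/ n 0 ⟨
    toℚᵘ (ι n)   ∎)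
    where open ℚᵘ.≤-Reasoning

  ι-cancel-≤ : ∀ {m n} → ι m ≤ ι n → m ℕ.≤ n
  ι-cancel-≤ {m} {n} le = ℕ.≮⇒≥ (λ n<m → ℚ.<-irrefl refl (ℚ.<-≤-trans (ι-mono-< n<m) le))

  -- There will be `2 + N` layers, and giving up one of them lowers a ratio below 2 by less than
  -- `2 / (2 + N)`. For `ε = (a + 1) / (d + 1)` take `N = 2d`: the product is then `2 (a + 1)`.
  archimedean : ∀ ε → Positive ε → ∃ λ N → ι 2 ≤ ε * ι (2 ℕ.+ N)
  archimedean ε@(mkℚ (+ suc a) d _) _ = d ℕ.+ d , ℚ.toℚᵘ-cancel-≤ (begin
    toℚᵘ (ι 2)                          ≃⟨ toℚᵘ-/ 2 0 ⟩
    mkℚᵘ (+ 2) 0                        ≤⟨ *≤* (ℤ.+≤+ cross) ⟩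
    mkℚᵘ (+ suc a) d ℚᵘ.* mkℚᵘ (+ (2 ℕ.+ (d ℕ.+ d))) 0 ≃⟨ ℚᵘ.*-cong {mkℚᵘ (+ suc a) d} ℚᵘ.≃-refl (toℚᵘ-/ (2 ℕ.+ (d ℕ.+ d)) 0) ⟨
    toℚᵘ ε ℚᵘ.* toℚᵘ (ι (2 ℕ.+ (d ℕ.+ d)))  ≃⟨ ℚ.toℚᵘ-homo-* ε (ι (2 ℕ.+ (d ℕ.+ d))) ⟨
    toℚᵘ (ε * ι (2 ℕ.+ (d ℕ.+ d)))          ∎)
    where
    open ℚᵘ.≤-Reasoning
    cross : 2 ℕ.* (suc d ℕ.* 1) ℕ.≤ (suc a ℕ.* (2 ℕ.+ (d ℕ.+ d))) ℕ.* 1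
    cross = ℕ.≤-trans (ℕ.≤-reflexive (solve 1 (λ d → con 2 :* ((con 1 :+ d) :* con 1) := con 2 :+ (d :+ d)) refl d))
            (ℕ.≤-trans (ℕ.m≤m+n _ _) (ℕ.≤-reflexive (sym (ℕ.*-identityʳ _))))
      where open +-*-Solver

sumℚ-ι : ∀ n {f : Fin n → ℚ} {g : Fin n → ℕ} → (∀ i → f i ≡ ι (g i)) → sumℚ n f ≡ ι (sum g)
sumℚ-ι zero    eq = sym ι-0
sumℚ-ι (suc n) {g = g} eq = trans (cong₂ _+_ (eq zero) (sumℚ-ι n (eq ∘ suc))) (sym (ι-+ (g zero) _))

0≤ι : ∀ n → 0ℚ ≤ ι n
0≤ι n = subst (_≤ ι n) ι-0 (ι-mono-≤ {0} {n} z≤n)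

-- Weak duality for capacitated edge sets.

countB-sum : ∀ n (f : Fin n → Bool) → countB n f ≡ sum (𝟙 ∘ f)
countB-sum zero    f = refl
countB-sum (suc n) f = cong (𝟙 (f zero) ℕ.+_) (countB-sum n (f ∘ suc))

module Bipartite {nL nR : ℕ} (F : Fin nL → Fin nR → Bool) where

  total : (Fin nL → ℕ) → ℕ
  total p = sum (λ u → sum (λ v → if F u v then p u else 0))

  -- Charge each chosen edge to its two ends: `α u` is charged at most `C` times and `β v` at most
  -- once.
  weak-duality : ∀ {C p} α β →
    (∀ u → countB nR (F u) ℕ.≤ C) → (∀ v → countB nL (λ u → F u v) ℕ.≤ 1) →
    (∀ u v → F u v ≡ true → p u ℕ.≤ α u ℕ.+ β v) →
    total p ℕ.≤ C ℕ.* sum α ℕ.+ sum β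
  weak-duality {C} {p} α β capL capR cover = begin
    total p
      ≤⟨ sum-mono (λ u → sum-mono (covered u)) ⟩
    sum (λ u → sum (λ v → 𝟙 (F u v) ℕ.* α u ℕ.+ 𝟙 (F u v) ℕ.* β v))
      ≡⟨ sum-cong-≗ (λ u → ∑-distrib-+ (λ v → 𝟙 (F u v) ℕ.* α u) (λ v → 𝟙 (F u v) ℕ.* β v)) ⟩
    sum (λ u → sum (λ v → 𝟙 (F u v) ℕ.* α u) ℕ.+ sum (λ v → 𝟙 (F u v) ℕ.* β v))
      ≡⟨ ∑-distrib-+ (λ u → sum (λ v → 𝟙 (F u v) ℕ.* α u)) (λ u → sum (λ v → 𝟙 (F u v) ℕ.* β v)) ⟩
    sum (λ u → sum (λ v → 𝟙 (F u v) ℕ.* α u)) ℕ.+ sum (λ u → sum (λ v → 𝟙 (F u v) ℕ.* β v))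
      ≡⟨ cong₂ ℕ._+_ (sum-cong-≗ (λ u → sym (*-distribʳ-sum (α u) (λ v → 𝟙 (F u v)))))
           (trans (∑-comm (λ u v → 𝟙 (F u v) ℕ.* β v)) (sum-cong-≗ (λ v → sym (*-distribʳ-sum (β v) (λ u → 𝟙 (F u v)))))) ⟩
    sum (λ u → sum (λ v → 𝟙 (F u v)) ℕ.* α u) ℕ.+ sum (λ v → sum (λ u → 𝟙 (F u v)) ℕ.* β v)
      ≤⟨ ℕ.+-mono-≤ (sum-mono (λ u → ℕ.*-monoˡ-≤ (α u) (subst (ℕ._≤ C) (countB-sum nR (F u)) (capL u))))
                    (sum-mono (λ v → ℕ.≤-trans (ℕ.*-monoˡ-≤ (β v) (subst (ℕ._≤ 1) (countB-sum nL (λ u → F u v)) (capR v))) (ℕ.≤-reflexive (ℕ.*-identityˡ (β v))))) ⟩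
    sum (λ u → C ℕ.* α u) ℕ.+ sum β
      ≡⟨ cong (ℕ._+ sum β) (*-distribˡ-sum C α) ⟨
    C ℕ.* sum α ℕ.+ sum β ∎
    where
    open ℕ.≤-Reasoning
    covered : ∀ u v → (if F u v then p u else 0) ℕ.≤ 𝟙 (F u v) ℕ.* α u ℕ.+ 𝟙 (F u v) ℕ.* β v
    covered u v with F u v in eq
    ... | false = z≤n
    ... | true rewrite ℕ.+-identityʳ (α u) | ℕ.+-identityʳ (β v) = cover u v eq

-- The instance, the low pricing and the high pricing.

atZero : ℕ → Bool
atZero zero    = true
atZero (suc _) = false

atZero⁺ : ∀ {l} → atZero l ≡ true → l ≡ 0
atZero⁺ {zero} _ = refl

atZero⁻ : ∀ {l} → atZero l ≡ false → l ≢ 0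
atZero⁻ {suc _} _ ()

≢0⇒¬atZero : ∀ {l} → l ≢ 0 → atZero l ≡ false
≢0⇒¬atZero {zero}  l≢0 = ⊥-elim (l≢0 refl)
≢0⇒¬atZero {suc _} _   = refl

module Construction {c N k : ℕ} (c>0 : 1 ℕ.≤ c) (k>0 : 1 ℕ.≤ k) (G : LayeredGraph (suc N) (suc c) k) where
  open LayeredGraph G

  C H : ℕ
  C = suc c
  H = 2 ℕ.* C ℕ.∸ 1

  H≡c+C : H ≡ c ℕ.+ C
  H≡c+C = cong (c ℕ.+_) (ℕ.+-identityʳ C)

  C<H : C ℕ.< H
  C<H = subst (suc C ℕ.≤_) (sym H≡c+C) (ℕ.+-monoˡ-≤ C c>0)

  level : Fin n → ℕ
  level v = toℕ (layer v)

  own : Fin (n ℕ.* C) → Fin n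
  own = quotient C

  label : Fin (n ℕ.* C) → Fin C
  label = remainder {n} C

  pre : Fin (n ℕ.* C) → Fin n
  pre r = P (label r) ⟨$⟩ʳ own r

  own-combine : ∀ v j → own (combine v j) ≡ v
  own-combine v j = cong proj₁ (remQuot-combine v j)

  label-combine : ∀ (v : Fin n) j → label (combine v j) ≡ j
  label-combine v j = cong proj₂ (remQuot-combine v j)

  pre-combine : ∀ v j → pre (combine v j) ≡ P j ⟨$⟩ʳ v
  pre-combine v j = cong (λ (v , j) → P j ⟨$⟩ʳ v) (remQuot-combine v j)

  pre≢own : ∀ r → pre r ≢ own r
  pre≢own r = girth (own r) (label r , true) [] [-] k>0

  -- If `u = pre r`, then this is the level of `own r`. It is 0 exactly for `u` in the top layer.
  levelNext : Fin n → ℕ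
  levelNext u = toℕ (rotation (suc N) ⟨$⟩ˡ layer u)

  levelNext-pre : ∀ r → levelNext (pre r) ≡ level (own r)
  levelNext-pre r = cong toℕ (trans (cong (rotation (suc N) ⟨$⟩ˡ_) (layer-P (label r) (own r))) (inverseˡ (rotation (suc N))))


  budget : Fin n → Fin (n ℕ.* C) → Maybe ℚ
  budget u r = if does (own r ≟ u) then just (ι C)
               else if not (atZero (level (own r))) ∧ does (pre r ≟ u) then just (ι H)
               else nothing

  data Budget (u : Fin n) (r : Fin (n ℕ.* C)) (b : ℚ) : Set where
    owner : own r ≡ u → b ≡ ι C → Budget u r b
    rival : level (own r) ≢ 0 → pre r ≡ u → b ≡ ι H → Budget u r b

  budget⁻ : ∀ u r {b} → budget u r ≡ just b → Budget u r b
  budget⁻ u r eq with own r ≟ u | atZero (level (own r)) in l | pre r ≟ u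
  ... | yes p | _     | _     = owner p (sym (just-injective eq))
  ... | no _  | false | yes p = rival (atZero⁻ l) p (sym (just-injective eq))
  budget⁻ u r () | no _ | false | no _
  budget⁻ u r () | no _ | true  | _

  budget-own : ∀ {u r} → own r ≡ u → budget u r ≡ just (ι C)
  budget-own {u} {r} p rewrite dec-true (own r ≟ u) p = refl

  budget-pre : ∀ {u r} → level (own r) ≢ 0 → pre r ≡ u → budget u r ≡ just (ι H)
  budget-pre {u} {r} l refl
    rewrite dec-false (own r ≟ pre r) (λ p → pre≢own r (sym p)) | ≢0⇒¬atZero l | dec-true (pre r ≟ pre r) refl = refl

  budget-nonneg : ∀ u r b → budget u r ≡ just b → 0ℚ ≤ b
  budget-nonneg u r b eq with budget⁻ u r eq
  ... | owner _ refl   = 0≤ι C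
  ... | rival _ _ refl = 0≤ι H

  instance₀ : Instance
  instance₀ = record
    { nL = n ; nR = n ℕ.* C ; budget = budget ; budget≥0 = budget-nonneg
    ; capL = λ _ → just C ; capR = λ _ → just 1 }

  revenue-ι : ∀ {p pₙ} F → (∀ u → p u ≡ ι (pₙ u)) → revenue instance₀ p F ≡ ι (Bipartite.total F pₙ)
  revenue-ι {p} {pₙ} F eq = sumℚ-ι n (λ u → sumℚ-ι (n ℕ.* C) (λ r → term u (F u r)))
    where
    term : ∀ u b → (if b then p u else 0ℚ) ≡ ι (if b then pₙ u else 0)
    term u true  = eq u
    term u false = sym ι-0

  p : Pricing instance₀
  p = (λ _ → ι C) , λ u → combine u zero , budget-own (own-combine u zero)

  -- A vertex of the top layer has no edge of budget `H`, so `H` is not among its prices and it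
  -- charges `C`.
  qₙ : Fin n → ℕ
  qₙ u = if atZero (levelNext u) then C else H

  q : Pricing instance₀
  q = ι ∘ qₙ , offered
    where
    offered : ∀ u → ∃[ r ] (budget u r ≡ just (ι (qₙ u)))
    offered u with atZero (levelNext u) in eq
    ... | true  = combine u zero , budget-own (own-combine u zero)
    -- Any item of the next layer with rival `u` will do; this one comes from permutation `zero`.
    ... | false = r , budget-pre (λ l → atZero⁻ eq (trans (cong levelNext (sym pre≡u)) (trans (levelNext-pre r) l))) pre≡u
      where
      r = combine (P zero ⟨$⟩ˡ u) zero
      pre≡u : pre r ≡ u
      pre≡u = trans (pre-combine _ zero) (inverseʳ (P zero))

  module _ {p : Fin n → ℚ} {pₙ : Fin n → ℕ} (p≡ι : ∀ u → p u ≡ ι (pₙ u))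
           (α : Fin n → ℕ) (β : Fin (n ℕ.* C) → ℕ)
           (cover-own : ∀ r → pₙ (own r) ℕ.≤ C → pₙ (own r) ℕ.≤ α (own r) ℕ.+ β r)
           (cover-pre : ∀ r → level (own r) ≢ 0 → pₙ (pre r) ℕ.≤ α (pre r) ℕ.+ β r) where

    -- Feasibility of `F` means that an owner buys its item only at a price of at most `C`, which is
    -- the premise that `cover-own` may use.
    revenue-bound : ∀ F → Feasible instance₀ p F → revenue instance₀ p F ≤ ι (C ℕ.* sum α ℕ.+ sum β)
    revenue-bound F (F⊆E , capL , capR) = subst (_≤ ι (C ℕ.* sum α ℕ.+ sum β)) (sym (revenue-ι F p≡ι))
      (ι-mono-≤ (Bipartite.weak-duality F α β capL capR cover))
      where
      cover : ∀ u r → F u r ≡ true → pₙ u ℕ.≤ α u ℕ.+ β r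
      cover u r Fur with F⊆E u r Fur
      ... | b , eq , p≤b with budget⁻ u r eq
      ...   | owner refl refl     = cover-own r (ι-cancel-≤ (subst (_≤ ι C) (p≡ι (own r)) p≤b))
      ...   | rival l≢0 refl refl = cover-pre r l≢0

  sum-items : ∀ (f : Fin n → Fin C → ℕ) → sum (λ r → f (own r) (label r)) ≡ ∑[ v < n ] ∑[ j < C ] f v j
  sum-items f = trans (sum-combine n C (λ r → f (own r) (label r)))
    (sum-cong-≗ {n} (λ v → sum-cong-≗ {C} (λ j → cong₂ f (own-combine v j) (label-combine v j))))

  sum-δʳ : ∀ (u : Fin n) → sum (λ v → δ v u) ≡ 1
  sum-δʳ u = trans (sum-cong-≗ (λ v → trans (δ-sym v u) (sym (ℕ.*-identityʳ (δ u v))))) (sum-δ u (λ _ → 1))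

  column : ∀ (u : Fin n) → countB n (λ v → does (u ≟ v)) ≡ 1
  column u = trans (countB-sum n _) (trans (sum-cong-≗ (λ v → sym (ℕ.*-identityʳ (δ u v)))) (sum-δ u (λ _ → 1)))

  sold-p : EdgeSet instance₀
  sold-p u r = does (own r ≟ u)

  sold-p-feasible : Feasible instance₀ (proj₁ p) sold-p
  sold-p-feasible = sells , row , λ r → ℕ.≤-reflexive (column (own r))
    where
    sells : ∀ u r → sold-p u r ≡ true → ∃[ b ] (budget u r ≡ just b × ι C ≤ b)
    sells u r eq with own r ≟ u
    ... | yes _ = ι C , refl , ℚ.≤-refl
    row : ∀ u → countB (n ℕ.* C) (sold-p u) ℕ.≤ C
    row u = ℕ.≤-reflexive (begin
      countB (n ℕ.* C) (sold-p u)      ≡⟨ countB-sum (n ℕ.* C) (sold-p u) ⟩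
      sum (λ r → δ (own r) u)          ≡⟨ sum-items (λ v _ → δ v u) ⟩
      sum {n} (λ v → ∑[ j < C ] δ v u) ≡⟨ sum-cong-≗ (λ v → sum-const C (δ v u)) ⟩
      sum (λ v → C ℕ.* δ v u)          ≡⟨ *-distribˡ-sum C (λ v → δ v u) ⟨
      C ℕ.* sum (λ v → δ v u)          ≡⟨ trans (cong (C ℕ.*_) (sum-δʳ u)) (ℕ.*-identityʳ C) ⟩
      C ∎)
      where open ≡-Reasoning

  sold-p-revenue : revenue instance₀ (proj₁ p) sold-p ≡ ι (C ℕ.* (n ℕ.* C))
  sold-p-revenue = trans (revenue-ι sold-p (λ _ → refl)) (cong ι (begin
    sum (λ u → sum (λ r → if does (own r ≟ u) then C else 0)) ≡⟨ ∑-comm (λ u r → if does (own r ≟ u) then C else 0) ⟩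
    sum (λ r → sum (λ u → if does (own r ≟ u) then C else 0)) ≡⟨ sum-cong-≗ (λ r → sum-if-δ (own r) (λ _ → C)) ⟩
    sum {n ℕ.* C} (λ r → C)                                   ≡⟨ trans (sum-const (n ℕ.* C) C) (ℕ.*-comm (n ℕ.* C) C) ⟩
    C ℕ.* (n ℕ.* C) ∎))
    where open ≡-Reasoning

  p-bound : ∀ F → Feasible instance₀ (proj₁ p) F → revenue instance₀ (proj₁ p) F ≤ ι (C ℕ.* (n ℕ.* C))
  p-bound F feas = subst (λ x → revenue instance₀ (proj₁ p) F ≤ ι x) total
    -- The dual solution puts weight `C` on every vertex of L and nothing on the items.
    (revenue-bound (λ _ → refl) (λ _ → C) (λ _ → 0) (λ _ _ → ℕ.m≤m+n C 0) (λ _ _ → ℕ.m≤m+n C 0) F feas)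
    where
    total : C ℕ.* sum {n} (λ _ → C) ℕ.+ sum {n ℕ.* C} (λ _ → 0) ≡ C ℕ.* (n ℕ.* C)
    total = trans (cong₂ ℕ._+_ (cong (C ℕ.*_) (sum-const n C)) (trans (sum-const (n ℕ.* C) 0) (ℕ.*-zeroʳ (n ℕ.* C)))) (ℕ.+-identityʳ _)

  p-val : IsVal instance₀ p (ι (C ℕ.* (n ℕ.* C)))
  p-val = (sold-p , sold-p-feasible , sold-p-revenue) , p-bound

  -- The weight of each item of `v` in a dual solution for `q` that puts all weight on the items. It
  -- is also what the item earns in `sold-q`.
  qβ : Fin n → ℕ
  qβ v = if atZero (level v) then 0 else H

  sold-q : EdgeSet instance₀
  sold-q u r = not (atZero (level (own r))) ∧ does (pre r ≟ u)

  qₙ≤H : ∀ u → qₙ u ℕ.≤ H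
  qₙ≤H u with atZero (levelNext u)
  ... | true  = ℕ.<⇒≤ C<H
  ... | false = ℕ.≤-refl

  sold-q-feasible : Feasible instance₀ (proj₁ q) sold-q
  sold-q-feasible = sells , row , col
    where
    sells : ∀ u r → sold-q u r ≡ true → ∃[ b ] (budget u r ≡ just b × ι (qₙ u) ≤ b)
    sells u r eq with atZero (level (own r)) in l | pre r ≟ u
    sells u r () | true  | _
    sells u r () | false | no _
    ... | false | yes p = ι H , offer , ι-mono-≤ (qₙ≤H u)
      where
      offer : (if does (own r ≟ u) then just (ι C) else just (ι H)) ≡ just (ι H)
      offer with own r ≟ u
      ... | yes o = ⊥-elim (pre≢own r (trans p (sym o)))
      ... | no _  = refl
    𝟙-∧ : ∀ a b → 𝟙 (a ∧ b) ℕ.≤ 𝟙 b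
    𝟙-∧ true  b = ℕ.≤-refl
    𝟙-∧ false b = z≤n
    row : ∀ u → countB (n ℕ.* C) (sold-q u) ℕ.≤ C
    row u = begin
      countB (n ℕ.* C) (sold-q u)
        ≡⟨ countB-sum (n ℕ.* C) (sold-q u) ⟩
      sum (𝟙 ∘ sold-q u)
        ≤⟨ sum-mono (λ r → 𝟙-∧ (not (atZero (level (own r)))) (does (pre r ≟ u))) ⟩
      sum (λ r → δ (pre r) u)
        ≡⟨ sum-items (λ v j → δ (P j ⟨$⟩ʳ v) u) ⟩
      sum {n} (λ v → ∑[ j < C ] δ (P j ⟨$⟩ʳ v) u)
        ≡⟨ ∑-comm {n} {C} (λ v j → δ (P j ⟨$⟩ʳ v) u) ⟩
      sum {C} (λ j → sum (λ v → δ (P j ⟨$⟩ʳ v) u))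
        ≡⟨ sum-cong-≗ {C} (λ j → trans (sum-perm (λ v → δ v u) (P j)) (sum-δʳ u)) ⟩
      sum {C} (λ j → 1)
        ≡⟨ trans (sum-const C 1) (ℕ.*-identityʳ C) ⟩
      C ∎
      where open ℕ.≤-Reasoning
    col : ∀ r → countB n (λ u → sold-q u r) ℕ.≤ 1
    col r = begin
      countB n (λ u → sold-q u r)         ≡⟨ countB-sum n (λ u → sold-q u r) ⟩
      sum (λ u → 𝟙 (sold-q u r))          ≤⟨ sum-mono (λ u → 𝟙-∧ (not (atZero (level (own r)))) (does (pre r ≟ u))) ⟩
      sum (λ u → δ (pre r) u)             ≡⟨ countB-sum n (λ u → does (pre r ≟ u)) ⟨
      countB n (λ u → does (pre r ≟ u))   ≡⟨ column (pre r) ⟩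
      1 ∎
      where open ℕ.≤-Reasoning

  sum-qβ : sum (qβ ∘ own) ≡ C ℕ.* (M ℕ.* (suc N ℕ.* H))
  sum-qβ = begin
    sum (qβ ∘ own)                    ≡⟨ sum-items (λ v _ → qβ v) ⟩
    sum {n} (λ v → ∑[ j < C ] qβ v)   ≡⟨ sum-cong-≗ (λ v → sum-const C (qβ v)) ⟩
    sum (λ v → C ℕ.* qβ v)            ≡⟨ *-distribˡ-sum C qβ ⟨
    C ℕ.* sum qβ                      ≡⟨ cong (C ℕ.*_) (sum-layer (λ i → if atZero (toℕ i) then 0 else H)) ⟩
    -- Layer 0 contributes nothing, which leaves `N + 1` of the `N + 2` layers.
    C ℕ.* (M ℕ.* sum {suc N} (λ i → H)) ≡⟨ cong (λ s → C ℕ.* (M ℕ.* s)) (sum-const (suc N) H) ⟩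
    C ℕ.* (M ℕ.* (suc N ℕ.* H))       ∎
    where open ≡-Reasoning

  sold-q-revenue : revenue instance₀ (proj₁ q) sold-q ≡ ι (sum (qβ ∘ own))
  sold-q-revenue = trans (revenue-ι sold-q (λ _ → refl)) (cong ι
    (trans (∑-comm (λ u r → if sold-q u r then qₙ u else 0)) (sum-cong-≗ item)))
    where
    item : ∀ r → sum (λ u → if sold-q u r then qₙ u else 0) ≡ qβ (own r)
    item r with atZero (level (own r)) in eq
    ... | true  = trans (sum-const n 0) (ℕ.*-zeroʳ n)
    ... | false = trans (sum-if-δ (pre r) qₙ) (cong (λ b → if b then C else H) (trans (cong atZero (levelNext-pre r)) eq))

  -- With at least two layers, the rotation sends 0 to a top layer different from 0.
  rotation-zero : ∀ i → toℕ i ≡ 0 → toℕ (rotation (suc N) ⟨$⟩ˡ i) ≢ 0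
  rotation-zero i i≡0 r≡0
    with refl ← toℕ-injective {i = i} {zero} i≡0
    with () ← trans (sym (inverseʳ (rotation (suc N)) {zero})) (cong (rotation (suc N) ⟨$⟩ʳ_) (toℕ-injective {j = zero} r≡0))

  q-bound : ∀ F → Feasible instance₀ (proj₁ q) F → revenue instance₀ (proj₁ q) F ≤ ι (sum (qβ ∘ own))
  q-bound F feas = subst (λ x → revenue instance₀ (proj₁ q) F ≤ ι x) total
    (revenue-bound (λ _ → refl) (λ _ → 0) (qβ ∘ own) cover-own cover-pre F feas)
    where
    total : C ℕ.* sum {n} (λ _ → 0) ℕ.+ sum (qβ ∘ own) ≡ sum (qβ ∘ own)
    total = cong (ℕ._+ sum (qβ ∘ own)) (trans (cong (C ℕ.*_) (trans (sum-const n 0) (ℕ.*-zeroʳ n))) (ℕ.*-zeroʳ C))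
    cover-own : ∀ r → qₙ (own r) ℕ.≤ C → qₙ (own r) ℕ.≤ qβ (own r)
    cover-own r q≤C with atZero (level (own r)) in l
    ... | false = qₙ≤H (own r)
    -- An item of layer 0 has weight 0, but its owner is not in the top layer and charges `H`, which
    -- exceeds the budget `C`.
    ... | true with atZero (levelNext (own r)) in l′
    ...   | true  = ⊥-elim (rotation-zero (layer (own r)) (atZero⁺ l) (atZero⁺ l′))
    ...   | false = ⊥-elim (ℕ.<⇒≱ C<H q≤C)
    cover-pre : ∀ r → level (own r) ≢ 0 → qₙ (pre r) ℕ.≤ qβ (own r)
    cover-pre r l rewrite ≢0⇒¬atZero l = qₙ≤H (pre r)

  q-val : IsVal instance₀ q (ι (sum (qβ ∘ own)))
  q-val = (sold-q , sold-q-feasible , sold-q-revenue) , q-bound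

  -- A dual solution for a pricing after a swap.

  module Swap (p′ : Pricing instance₀) where

    T : Fin n → Bool
    T u = does (proj₁ p′ u ℚ.≟ ι H)

    open Reach G T using (reach; T⊆reach; reach-closed; returns; returns≤size; size-reach)

    pₙ : Fin n → ℕ
    pₙ u = if T u then H else C

    p′≡ι : ∀ u → proj₁ p′ u ≡ ι (pₙ u)
    p′≡ι u with proj₁ p′ u ℚ.≟ ι H
    ... | yes eq = eq
    ... | no ¬H with proj₂ p′ u
    ...   | r , eq with budget⁻ u r eq
    ...     | owner _ p≡C   = p≡C
    ...     | rival _ _ p≡H = ⊥-elim (¬H p≡H)

    -- Outside `reach` the weights are those used for `p`. Inside, weight `C` moves from each vertex
    -- to its items, and a vertex of `T` keeps `c` in order to cover `H = c + C`.
    α : Fin n → ℕ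
    α u = if reach u then (if T u then c else 0) else C

    -- An owner in `T` charges more than `C` and cannot sell its own items, so these need weight
    -- only where the rival lies in `reach`. Those are the arcs counted by `returns`.
    β : Fin n → Fin C → ℕ
    β v j = if T v then (if reach (P j ⟨$⟩ʳ v) then C else 0) else if reach v then C else 0

    cover-own : ∀ r → pₙ (own r) ℕ.≤ C → pₙ (own r) ℕ.≤ α (own r) ℕ.+ β (own r) (label r)
    cover-own r le with T (own r) | reach (own r)
    ... | true  | _     = ⊥-elim (ℕ.<⇒≱ C<H le)
    ... | false | true  = ℕ.≤-refl
    ... | false | false = ℕ.m≤m+n C 0

    cover-pre : ∀ r → level (own r) ≢ 0 → pₙ (pre r) ℕ.≤ α (pre r) ℕ.+ β (own r) (label r)
    cover-pre r l≢0 with reach (pre r) in Rpre | T (pre r) in Tpre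
    ... | false | true with () ← trans (sym Rpre) (T⊆reach Tpre)
    ... | false | false = ℕ.m≤m+n C _
    -- As `reach` is closed upwards, the owner lies in it as well, and the item has weight `C`
    -- whether or not the owner is in `T`.
    ... | true | b rewrite reach-closed (label r) (own r) l≢0 Rpre with T (own r)
    cover-pre r l≢0 | true | true  | true  = ℕ.≤-reflexive H≡c+C
    cover-pre r l≢0 | true | true  | false = ℕ.≤-reflexive H≡c+C
    cover-pre r l≢0 | true | false | true  = ℕ.≤-refl
    cover-pre r l≢0 | true | false | false = ℕ.≤-refl

    -- Here and in `sum-β` the negative terms are moved to the other side, since subtraction of
    -- natural numbers truncates.
    sum-α : sum α ℕ.+ C ℕ.* size reach ≡ n ℕ.* C ℕ.+ c ℕ.* size T
    sum-α = begin
      sum α ℕ.+ C ℕ.* size reach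
        ≡⟨ cong (sum α ℕ.+_) (*-distribˡ-sum C (𝟙 ∘ reach)) ⟩
      sum α ℕ.+ sum (λ u → C ℕ.* 𝟙 (reach u))
        ≡⟨ ∑-distrib-+ α (λ u → C ℕ.* 𝟙 (reach u)) ⟨
      sum (λ u → α u ℕ.+ C ℕ.* 𝟙 (reach u))
        ≡⟨ sum-cong-≗ pointwise ⟩
      sum (λ u → C ℕ.+ c ℕ.* 𝟙 (T u))
        ≡⟨ ∑-distrib-+ (λ _ → C) (λ u → c ℕ.* 𝟙 (T u)) ⟩
      sum {n} (λ _ → C) ℕ.+ sum (λ u → c ℕ.* 𝟙 (T u))
        ≡⟨ cong₂ ℕ._+_ (sum-const n C) (sym (*-distribˡ-sum c (𝟙 ∘ T))) ⟩
      n ℕ.* C ℕ.+ c ℕ.* size T ∎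
      where
      open ≡-Reasoning
      pointwise : ∀ u → α u ℕ.+ C ℕ.* 𝟙 (reach u) ≡ C ℕ.+ c ℕ.* 𝟙 (T u)
      pointwise u with T u in Tu | reach u in Ru
      ... | true | false with () ← trans (sym Ru) (T⊆reach Tu)
      ... | true  | true  = solve 1 (λ c → c :+ (con 1 :+ c) :* con 1 := (con 1 :+ c) :+ c :* con 1) refl c
        where open +-*-Solver
      ... | false | true  = solve 1 (λ c → (con 1 :+ c) :* con 1 := (con 1 :+ c) :+ c :* con 0) refl c
        where open +-*-Solver
      ... | false | false = solve 1 (λ c → (con 1 :+ c) :+ (con 1 :+ c) :* con 0 := (con 1 :+ c) :+ c :* con 0) refl c
        where open +-*-Solver

    sum-β : sum (λ r → β (own r) (label r)) ℕ.+ C ℕ.* (C ℕ.* size T) ≡ C ℕ.* (C ℕ.* size reach) ℕ.+ C ℕ.* returns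
    sum-β = begin
      sum (λ r → β (own r) (label r)) ℕ.+ C ℕ.* (C ℕ.* size T)
        ≡⟨ cong₂ ℕ._+_ (sum-items β) (scale (𝟙 ∘ T)) ⟩
      sum (λ v → ∑[ j < C ] β v j) ℕ.+ sum {n} (λ v → ∑[ j < C ] (C ℕ.* 𝟙 (T v)))
        ≡⟨ add β (λ v _ → C ℕ.* 𝟙 (T v)) ⟩
      sum (λ v → ∑[ j < C ] (β v j ℕ.+ C ℕ.* 𝟙 (T v)))
        ≡⟨ sum-cong-≗ (λ v → sum-cong-≗ (λ j → pointwise v j)) ⟩
      sum (λ v → ∑[ j < C ] (C ℕ.* 𝟙 (reach v) ℕ.+ C ℕ.* ret v j))
        ≡⟨ add (λ v _ → C ℕ.* 𝟙 (reach v)) (λ v j → C ℕ.* ret v j) ⟨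
      sum {n} (λ v → ∑[ j < C ] (C ℕ.* 𝟙 (reach v))) ℕ.+ sum (λ v → ∑[ j < C ] (C ℕ.* ret v j))
        ≡⟨ cong₂ ℕ._+_ (scale (𝟙 ∘ reach)) (trans (*-distribˡ-sum C (λ v → ∑[ j < C ] ret v j)) (sum-cong-≗ (λ v → *-distribˡ-sum C (ret v)))) ⟨
      C ℕ.* (C ℕ.* size reach) ℕ.+ C ℕ.* returns ∎
      where
      open ≡-Reasoning
      ret : Fin n → Fin C → ℕ
      ret v j = 𝟙 (T v) ℕ.* 𝟙 (reach (P j ⟨$⟩ʳ v))
      scale : ∀ (f : Fin n → ℕ) → C ℕ.* (C ℕ.* sum f) ≡ sum {n} (λ v → ∑[ j < C ] (C ℕ.* f v))
      scale f = trans (cong (C ℕ.*_) (*-distribˡ-sum C f))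
        (trans (*-distribˡ-sum C (λ v → C ℕ.* f v)) (sum-cong-≗ (λ v → sym (sum-const C (C ℕ.* f v)))))
      add : ∀ (f g : Fin n → Fin C → ℕ) → sum (λ v → sum (f v)) ℕ.+ sum (λ v → sum (g v)) ≡ sum (λ v → ∑[ j < C ] (f v j ℕ.+ g v j))
      add f g = trans (sym (∑-distrib-+ (λ v → sum (f v)) (λ v → sum (g v)))) (sum-cong-≗ (λ v → sym (∑-distrib-+ (f v) (g v))))
      pointwise : ∀ v j → β v j ℕ.+ C ℕ.* 𝟙 (T v) ≡ C ℕ.* 𝟙 (reach v) ℕ.+ C ℕ.* ret v j
      pointwise v j with T v in Tv | reach v in Rv | reach (P j ⟨$⟩ʳ v)
      ... | true | false | _ with () ← trans (sym Rv) (T⊆reach Tv)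
      ... | true  | true  | true  = cong (ℕ._+ C ℕ.* 1) (sym (ℕ.*-identityʳ C))
      ... | true  | true  | false = trans (sym (ℕ.+-identityʳ _)) (cong (C ℕ.* 1 ℕ.+_) (sym (ℕ.*-zeroʳ C)))
      ... | false | true  | _     = cong (ℕ._+ C ℕ.* 0) (sym (ℕ.*-identityʳ C))
      ... | false | false | _     = cong (ℕ._+ C ℕ.* 0) (sym (ℕ.*-zeroʳ C))

    -- The terms in `size reach` cancel. As `c = C - 1`, the dual value exceeds `C * (n * C)` by
    -- `C * (returns - size T)`, which is not positive.
    dual-value : size reach ℕ.≤ k → C ℕ.* sum α ℕ.+ sum (λ r → β (own r) (label r)) ℕ.≤ C ℕ.* (n ℕ.* C)
    dual-value small = ℕ.+-cancelʳ-≤ (C ℕ.* (C ℕ.* s) ℕ.+ C ℕ.* (C ℕ.* t)) _ _ (begin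
      C ℕ.* a ℕ.+ b ℕ.+ (C ℕ.* (C ℕ.* s) ℕ.+ C ℕ.* (C ℕ.* t))
        ≡⟨ solve 5 (λ C a b s t → C :* a :+ b :+ (C :* (C :* s) :+ C :* (C :* t)) := C :* (a :+ C :* s) :+ (b :+ C :* (C :* t))) refl C a b s t ⟩
      C ℕ.* (a ℕ.+ C ℕ.* s) ℕ.+ (b ℕ.+ C ℕ.* (C ℕ.* t))
        ≡⟨ cong₂ (λ x y → C ℕ.* x ℕ.+ y) sum-α sum-β ⟩
      C ℕ.* (n ℕ.* C ℕ.+ c ℕ.* t) ℕ.+ (C ℕ.* (C ℕ.* s) ℕ.+ C ℕ.* returns)
        ≤⟨ ℕ.+-monoʳ-≤ (C ℕ.* (n ℕ.* C ℕ.+ c ℕ.* t)) (ℕ.+-monoʳ-≤ (C ℕ.* (C ℕ.* s)) (ℕ.*-monoʳ-≤ C (returns≤size small))) ⟩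
      C ℕ.* (n ℕ.* C ℕ.+ c ℕ.* t) ℕ.+ (C ℕ.* (C ℕ.* s) ℕ.+ C ℕ.* t)
        ≡⟨ solve 4 (λ c n s t → let C = con 1 :+ c in
             C :* (n :* C :+ c :* t) :+ (C :* (C :* s) :+ C :* t) := C :* (n :* C) :+ (C :* (C :* s) :+ C :* (C :* t))) refl c n s t ⟩
      C ℕ.* (n ℕ.* C) ℕ.+ (C ℕ.* (C ℕ.* s) ℕ.+ C ℕ.* (C ℕ.* t)) ∎)
      where
      open ℕ.≤-Reasoning
      open +-*-Solver
      a = sum α
      b = sum (λ r → β (own r) (label r))
      s = size reach
      t = size T

    swap-bound : ∀ {ρ} → DiffersOnAtMost instance₀ ρ p p′ → reachBound C ρ (suc N) ℕ.≤ k →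
                 ∀ F → Feasible instance₀ (proj₁ p′) F → revenue instance₀ (proj₁ p′) F ≤ ι (C ℕ.* (n ℕ.* C))
    swap-bound {ρ} (S , |S|≤ρ , same) ρ≤k F feas = ℚ.≤-trans
      (revenue-bound p′≡ι α (λ r → β (own r) (label r)) cover-own cover-pre F feas)
      (ι-mono-≤ (dual-value (ℕ.≤-trans (size-reach (ℕ.≤-trans (size≤length T S T⊆S) |S|≤ρ)) ρ≤k)))
      where
      -- As `p` charges `C < H`, a vertex with price `H` has been changed.
      T⊆S : ∀ u → T u ≡ true → u ∈ S
      T⊆S u Tu with proj₁ p′ u ℚ.≟ ι H | _∈?_ _≟_ u S
      ... | _       | yes u∈S = u∈S
      ... | yes p≡H | no u∉S  = ⊥-elim (ℕ.<⇒≱ C<H (ι-cancel-≤ (ℚ.≤-reflexive (trans (sym p≡H) (same u u∉S)))))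
      T⊆S u () | no _ | no _

  -- Local optimality and the ratio of the two values.

  p-localOpt : ∀ {ρ} → reachBound C ρ (suc N) ℕ.≤ k → LocalOpt instance₀ ρ p
  p-localOpt ρ≤k p′ diff x x′ (_ , p-max) ((F , feas , eq) , _) = begin
    x′                                     ≡⟨ eq ⟨
    revenue instance₀ (proj₁ p′) F         ≤⟨ Swap.swap-bound p′ diff ρ≤k F feas ⟩
    ι (C ℕ.* (n ℕ.* C))                    ≡⟨ sold-p-revenue ⟨
    revenue instance₀ (proj₁ p) sold-p     ≤⟨ p-max sold-p sold-p-feasible ⟩
    x ∎
    where open ℚ.≤-Reasoning

  n≡ : n ≡ M ℕ.* (2 ℕ.+ N)
  n≡ = begin
    n                              ≡⟨ trans (sum-const n 1) (ℕ.*-identityʳ n) ⟨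
    sum {n} (λ _ → 1)              ≡⟨ sum-layer (λ _ → 1) ⟩
    M ℕ.* sum {2 ℕ.+ N} (λ _ → 1)  ≡⟨ cong (M ℕ.*_) (trans (sum-const (2 ℕ.+ N) 1) (ℕ.*-identityʳ (2 ℕ.+ N))) ⟩
    M ℕ.* (2 ℕ.+ N)                ∎
    where open ≡-Reasoning

  q-positive : 0ℚ < ι (sum (qβ ∘ own))
  q-positive = subst (_< ι (sum (qβ ∘ own))) ι-0 (ι-mono-< {0} (subst (0 ℕ.<_) (sym sum-qβ)
    (ℕ.*-mono-≤ {1} {C} {1} (s≤s z≤n) (ℕ.*-mono-≤ {1} {M} {1} M>0 (ℕ.*-mono-≤ {1} {suc N} {1} (s≤s z≤n) (ℕ.≤-trans (s≤s z≤n) C<H))))))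

  -- With `Y` the value of `q`, `H / C` times the value of `p` is `lost + Y`, where `lost` is what
  -- the `C * M` items of layer 0 would earn at price `H`. Since `H ≤ 2C`, `lost` is at most
  -- `2 / (2 + N)` times the value of `p`.
  gap : ∀ ε → ι 2 ≤ ε * ι (2 ℕ.+ N) → (+ H / C - ε) * ι (C ℕ.* (n ℕ.* C)) ≤ ι (sum (qβ ∘ own))
  gap ε 2≤εN = begin
    (h - ε) * X                      ≡⟨ ℚ.*-distribʳ-+ X h (- ε) ⟩
    h * X + - ε * X                  ≡⟨ cong₂ _+_ (/-*-ι H c (C ℕ.* (n ℕ.* C)) (lost ℕ.+ sum (qβ ∘ own)) scaled) (sym (ℚ.neg-distribˡ-* ε X)) ⟩
    ι (lost ℕ.+ Y) - ε * X           ≤⟨ ℚ.+-monoʳ-≤ (ι (lost ℕ.+ Y)) (ℚ.neg-antimono-≤ lost≤) ⟩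
    ι (lost ℕ.+ Y) - ι lost          ≡⟨ cong (_- ι lost) (trans (ι-+ lost Y) (ℚ.+-comm (ι lost) (ι Y))) ⟩
    ι Y + ι lost - ι lost            ≡⟨ ℚ.+-assoc (ι Y) (ι lost) (- ι lost) ⟩
    ι Y + (ι lost - ι lost)          ≡⟨ cong (λ z → ι Y + z) (ℚ.+-inverseʳ (ι lost)) ⟩
    ι Y + 0ℚ                         ≡⟨ ℚ.+-identityʳ (ι Y) ⟩
    ι Y ∎
    where
    open ℚ.≤-Reasoning
    h = + H / C
    X = ι (C ℕ.* (n ℕ.* C))
    Y = sum (qβ ∘ own)
    lost = C ℕ.* (M ℕ.* H)
    W = M ℕ.* C ℕ.* C
    scaled : H ℕ.* (C ℕ.* (n ℕ.* C)) ≡ (lost ℕ.+ Y) ℕ.* C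
    scaled rewrite sum-qβ | n≡ = solve 4 (λ h c m l →
      h :* (c :* (m :* (con 1 :+ l) :* c)) := (c :* (m :* h) :+ c :* (m :* (l :* h))) :* c) refl H C M (suc N)
      where open +-*-Solver
    H≤2C : H ℕ.≤ 2 ℕ.* C
    H≤2C = ℕ.m∸n≤m (2 ℕ.* C) 1
    lost≤ : ι lost ≤ ε * X
    lost≤ = begin
      ι lost                        ≤⟨ ι-mono-≤ (ℕ.≤-trans (ℕ.*-monoʳ-≤ C (ℕ.*-monoʳ-≤ M H≤2C))
                                        (ℕ.≤-reflexive (solve 2 (λ c m → c :* (m :* (con 2 :* c)) := con 2 :* (m :* c :* c)) refl C M))) ⟩
      ι (2 ℕ.* W)                   ≡⟨ ι-* 2 W ⟩
      ι 2 * ι W                     ≤⟨ ℚ.*-monoʳ-≤-nonNeg (ι W) {{nonNegative (0≤ι W)}} 2≤εN ⟩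
      ε * ι (2 ℕ.+ N) * ι W         ≡⟨ ℚ.*-assoc ε (ι (2 ℕ.+ N)) (ι W) ⟩
      ε * (ι (2 ℕ.+ N) * ι W)       ≡⟨ cong (ε *_) (trans (sym (ι-* (2 ℕ.+ N) W)) (cong ι items)) ⟩
      ε * X                         ∎
      where
      open +-*-Solver
      items : (2 ℕ.+ N) ℕ.* W ≡ C ℕ.* (n ℕ.* C)
      items rewrite n≡ = solve 3 (λ c m l → l :* (m :* c :* c) := c :* (m :* l :* c)) refl C M (2 ℕ.+ N)

theorem12 : ∀ (C : ℕ) .{{_ : NonZero C}} → 2 ℕ.≤ C → ∀ (ρ : ℕ) → 1 ℕ.≤ ρ →
    ∀ (ε : ℚ) → Positive ε →
    ∃[ I ] ((∀ u → Instance.capL I u ≡ just C)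
    × (∀ v → Instance.capR I v ≡ just 1)
    × ∃[ p ] ∃[ q ] ∃[ x ] ∃[ y ]
    (LocalOpt I ρ p × IsVal I p x × IsVal I q y × 0ℚ < y
    × ((+ (2 ℕ.* C ℕ.∸ 1) / C) - ε) * x ≤ y))
theorem12 (suc c) (s≤s c>0) ρ ρ>0 ε ε>0 with archimedean ε ε>0
... | N , 2≤εN = instance₀ , (λ _ → refl) , (λ _ → refl) , p , q , _ , _ ,
      p-localOpt ℕ.≤-refl , p-val , q-val , q-positive , gap ε 2≤εN
  where
  -- The girth bound is the largest size that the reachable set may have after a swap of `ρ`
  -- vertices; levels go up to `N + 1`. It is at least `ρ`, hence positive.
  k = reachBound (suc c) ρ (suc N)
  open Construction c>0 (ℕ.≤-trans ρ>0 (ℕ.m≤m+n ρ _)) (layeredGraph (suc N) (suc c) k)
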